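{- Let $\mathscr{A}\subseteq\mathbb{N}$ be an OR$_+$ sequence. Then in the probability space $\mathcal{S}_{\mathscr{A}}$, with random sequence $\omega$, $$\mathbb{E}(r_{\omega,h}(n))=\Theta\left(\frac{A(n)^h}{n}\right)\quad\text{for every integer }h\geq 1.$$
   Context: $\mathbb{N}$ includes $0$. A sequence $\mathscr{A}=\{a_0<a_1<\cdots\}$ is an infinite subset of $\mathbb{N}$, with counting function $A(x)=|\mathscr{A}\cap[0,x]|$. $\mathscr{A}$ is OR$_+$ if $A(2x)=O(A(x))$ and $a_{2n}=O(a_n)$. For an OR$_+$ sequence $\mathscr{A}$, $\mathcal{S}_{\mathscr{A}}$ is the probability space on the set of infinite subsets $\omega\subseteq\mathbb{N}$, with $\sigma$-algebra generated by the events $\{n\in\omega\}$ ($n\in\mathbb{N}$), in which these events are mutually independent with $\Pr(n\in\omega)=\frac{A(n)}{n+1}$. $r_{\omega,h}(n)$ is the number of ordered $h$-tuples $(k_1,\dots,k_h)\in\omega^h$ with $k_1+\cdots+k_h=n$. Asymptotics are as $n\to+\infty$; $f=\Theta(g)$ means $f=O(g)$ and $g=O(f)$. -}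

module Defs where

open import Level using (0ℓ; suc)
open import Algebra.Bundles using (CommutativeRing; Semiring)
import Algebra.Definitions.RawSemiring as RawSemiringDefinitions
open import Data.Bool.Base using (Bool; T; if_then_else_)
open import Data.Bool.Properties using (T?)
open import Data.Fin.Base using (toℕ)
open import Data.List.Base using (List; []; _∷_; length; filter; upTo; map; foldr; cartesianProductWith)
open import Data.List.Relation.Unary.Unique.Propositional using (Unique)
open import Data.Nat.Base as ℕ using (ℕ; zero)
import Data.Nat.Properties as ℕ
open import Data.Product.Base using (Σ-syntax; ∃-syntax; _×_)
open import Data.Vec.Base as Vec using (Vec)
open import Data.Vec.Relation.Unary.All as All using (All)
open import Function.Bundles using (_⇔_)
open import Relation.Binary.Core using (Rel)
open import Relation.Binary.PropositionalEquality.Core using (_≡_; _≢_)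
open import Relation.Binary.Structures using (IsDecTotalOrder)
import Relation.Binary.Construct.NonStrictToStrict as ToStrict
open import Relation.Nullary using (¬_; Dec; does)
open import Relation.Nullary.Decidable using (_×-dec_)
open import Relation.Unary using (Pred; U; ∁; _∩_; ⋃; _≐_; _⊥_)

-- Infinite subsets of ℕ, given by characteristic functions; classically every
-- subset of ℕ has one.

record InfiniteSubset : Set where
  field
    member   : ℕ → Bool
    infinite : ∀ n → ∃[ m ] (n ℕ.≤ m × T (member m))

open InfiniteSubset public

infix 4 _∈_ _∈?_

_∈_ : ℕ → InfiniteSubset → Set
n ∈ 𝒜 = T (member 𝒜 n)

_∈?_ : ∀ n 𝒜 → Dec (n ∈ 𝒜)
n ∈? 𝒜 = T? (member 𝒜 n)

count : InfiniteSubset → ℕ → ℕ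
count 𝒜 x = length (filter (_∈? 𝒜) (upTo (ℕ.suc x)))

IsEnumeration : (ℕ → ℕ) → InfiniteSubset → Set
IsEnumeration a 𝒜 = (∀ n → a n ℕ.< a (ℕ.suc n)) × (∀ k → k ∈ 𝒜 ⇔ (∃[ n ] a n ≡ k))

box : ∀ h → ℕ → List (Vec ℕ h)
box zero      n = Vec.[] ∷ []
box (ℕ.suc h) n = cartesianProductWith Vec._∷_ (upTo (ℕ.suc n)) (box h n)

-- The entries of a tuple with sum n are at most n, so that counting inside the
-- box [0,n]ʰ loses nothing.

r : (h n : ℕ) → InfiniteSubset → ℕ
r h n ω = length (filter (λ k → All.all? (_∈? ω) k ×-dec (Vec.sum k ℕ.≟ n)) (box h n))

-- The σ-algebra generated by a family of sets.  The constructors whole and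
-- intersection add nothing classically, but do not follow from the others
-- without excluded middle.

data Generated {Ω I : Set} (G : I → Pred Ω 0ℓ) : Pred Ω 0ℓ → Set (suc 0ℓ) where
  generator    : ∀ i → Generated G (G i)
  whole        : Generated G U
  complement   : ∀ {E} → Generated G E → Generated G (∁ E)
  intersection : ∀ {E F} → Generated G E → Generated G F → Generated G (E ∩ F)
  union        : ∀ {E : ℕ → Pred Ω 0ℓ} → (∀ i → Generated G (E i)) → Generated G (⋃ ℕ E)
  respects     : ∀ {E F} → E ≐ F → Generated G E → Generated G F

⋂generators : ∀ {Ω I : Set} → (I → Pred Ω 0ℓ) → List I → Pred Ω 0ℓ
⋂generators G []      = U
⋂generators G (i ∷ F) = G i ∩ ⋂generators G F

⋂-generated : ∀ {Ω I : Set} (G : I → Pred Ω 0ℓ) (F : List I) → Generated G (⋂generators G F)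
⋂-generated G []      = whole
⋂-generated G (i ∷ F) = intersection (generator i) (⋂-generated G F)

-- Archimedean Cauchy-complete ordered fields.  Up to isomorphism the field of
-- real numbers is the only one, so "for every ℝ : RealNumbers" speaks about
-- the reals.

record RealNumbers : Set (suc 0ℓ) where
  infix  4 _≤_
  infixl 7 _/_
  infix  8 _⁻¹
  field
    commutativeRing : CommutativeRing 0ℓ 0ℓ

  open CommutativeRing commutativeRing public
  open RawSemiringDefinitions (Semiring.rawSemiring semiring) public using (_^_; sum) renaming (_×_ to _·_)

  field
    _≤_             : Rel Carrier 0ℓ
    isDecTotalOrder : IsDecTotalOrder _≈_ _≤_
    +-monoˡ-≤       : ∀ {x y} z → x ≤ y → x + z ≤ y + z
    *-nonneg        : ∀ {x y} → 0# ≤ x → 0# ≤ y → 0# ≤ x * y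
    0≉1             : ¬ 0# ≈ 1#
    -- Total for convenience: 0# ⁻¹ is an arbitrary value.
    _⁻¹             : Carrier → Carrier
    ⁻¹-cong         : ∀ {x y} → x ≈ y → x ⁻¹ ≈ y ⁻¹
    ⁻¹-inverseʳ     : ∀ {x} → ¬ x ≈ 0# → x * x ⁻¹ ≈ 1#

  open IsDecTotalOrder isDecTotalOrder public using (_≤?_)
  open ToStrict _≈_ _≤_ public using (_<_)

  fromℕ : ℕ → Carrier
  fromℕ n = n · 1#

  _/_ : Carrier → Carrier → Carrier
  x / y = x * y ⁻¹

  ∣_∣ : Carrier → Carrier
  ∣ x ∣ = if does (0# ≤? x) then x else - x

  _ConvergesTo_ : (ℕ → Carrier) → Carrier → Set
  s ConvergesTo x = ∀ ε → 0# < ε → ∃[ N ] (∀ n → N ℕ.≤ n → ∣ s n - x ∣ ≤ ε)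

  IsCauchy : (ℕ → Carrier) → Set
  IsCauchy s = ∀ ε → 0# < ε → ∃[ N ] (∀ m n → N ℕ.≤ m → N ℕ.≤ n → ∣ s m - s n ∣ ≤ ε)

  field
    archimedean : ∀ x → ∃[ n ] x ≤ fromℕ n
    complete    : ∀ s → IsCauchy s → ∃[ x ] s ConvergesTo x

module Probability (ℝ : RealNumbers) where

  open RealNumbers ℝ

  infix 4 _=O_ _=Θ_

  _=O_ : (f g : ℕ → Carrier) → Set
  f =O g = ∃[ C ] ∃[ N ] (∀ n → N ℕ.≤ n → ∣ f n ∣ ≤ C * ∣ g n ∣)

  _=Θ_ : (f g : ℕ → Carrier) → Set
  f =Θ g = (f =O g) × (g =O f)

  -- For A(2x) = O(A(x)) it is enough to let x range over ℕ, because
  -- A(2m+1) ≤ A(2m) + 1.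

  record OR₊ (𝒜 : InfiniteSubset) : Set where
    field
      count-doubling : (λ x → fromℕ (count 𝒜 (2 ℕ.* x))) =O (λ x → fromℕ (count 𝒜 x))
      a              : ℕ → ℕ
      a-enumerates   : IsEnumeration a 𝒜
      a-doubling     : (λ n → fromℕ (a (2 ℕ.* n))) =O (λ n → fromℕ (a n))

  ∏ : List Carrier → Carrier
  ∏ = foldr _*_ 1#

  ∑< : ℕ → (ℕ → Carrier) → Carrier
  ∑< N f = sum {N} (λ i → f (toℕ i))

  record ProbabilityMeasure {Ω I : Set} (G : I → Pred Ω 0ℓ) : Set (suc 0ℓ) where
    field
      Pr        : ∀ {E} → Generated G E → Carrier
      -- In particular, Pr depends on the event only, not on the proof that it
      -- is measurable.
      Pr-cong   : ∀ {E F} (e : Generated G E) (f : Generated G F) → E ≐ F → Pr e ≈ Pr f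
      Pr-nonneg : ∀ {E} (e : Generated G E) → 0# ≤ Pr e
      Pr-whole  : Pr whole ≈ 1#
      Pr-union  : ∀ {E : ℕ → Pred Ω 0ℓ} (e : ∀ i → Generated G (E i)) →
                  (∀ i j → i ≢ j → E i ⊥ E j) →
                  (λ N → ∑< N (λ i → Pr (e i))) ConvergesTo Pr (union e)

    MutuallyIndependentGenerators : Set
    MutuallyIndependentGenerators =
      ∀ {F : List I} → Unique F → Pr (⋂-generated G F) ≈ ∏ (map (λ i → Pr (generator i)) F)

    -- X is measurable and 𝔼(X) = ∑ᵥ v · Pr(X = v) converges to e, for ℕ-valued X.
    HasExpectation : (Ω → ℕ) → Carrier → Set (suc 0ℓ)
    HasExpectation X e =
      Σ[ X-measurable ∈ (∀ v → Generated G (λ ω → X ω ≡ v)) ]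
        (λ N → ∑< N (λ v → fromℕ v * Pr (X-measurable v))) ConvergesTo e

  record 𝒮 (𝒜 : InfiniteSubset) : Set (suc 0ℓ) where
    field
      measure : ProbabilityMeasure {Ω = InfiniteSubset} (λ n ω → n ∈ ω)

    open ProbabilityMeasure measure public

    field
      independent : MutuallyIndependentGenerators
      Pr-∈        : ∀ n → Pr (generator n) ≈ fromℕ (count 𝒜 n) / fromℕ (ℕ.suc n)

{-# OPTIONS --safe #-}
module Submission where

open import Defs
open import Data.Bool.Base using (true; false; if_then_else_)
open import Data.Empty using (⊥-elim)
open import Data.Fin.Base as Fin using (Fin)
open import Data.List.Base using (List; []; _∷_; _++_; length; map; filter; upTo; allFin; cartesianProductWith)
import Data.List.Membership.Propositional as List
import Data.List.Membership.Propositional.Properties as List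
import Data.List.Properties as List
open import Data.List.Relation.Unary.All as Listᴬ using ()
open import Data.List.Relation.Unary.AllPairs using ([]; _∷_)
open import Data.List.Relation.Unary.Any using (here; there)
open import Data.List.Relation.Unary.Unique.Propositional using (Unique)
open import Data.Nat.Base as ℕ using (ℕ; zero; suc; z≤n; s≤s; _≡ᵇ_)
import Data.Nat.DivMod as ℕ
open import Data.Nat.Induction using (<-rec)
import Data.Nat.Properties as ℕ
open import Data.Nat.Solver using (module +-*-Solver)
open import Data.Product.Base using (_,_; _×_; ∃-syntax; proj₁; proj₂)
open import Data.Sum.Base using (inj₁; inj₂)
open import Data.Unit.Base using (tt)
open import Data.Vec.Base as Vec using (Vec; []; _∷_)
import Data.Vec.Membership.DecPropositional ℕ._≟_ as Vecᴹ
open import Data.Vec.Membership.Propositional.Properties using (∈-lookup)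
open import Data.Vec.Relation.Unary.All as Vecᴬ using (All; []; _∷_)
import Data.Vec.Relation.Unary.All.Properties as Vecᴬ
open import Data.Vec.Relation.Unary.Any as Any using (here; there)
open import Data.Vec.Relation.Unary.Any.Properties using (lookup-index)
open import Function.Base using (_∘_; id)
open import Function.Bundles using (Equivalence)
open import Level using (0ℓ)
open import Relation.Binary.Bundles using (Poset)
import Relation.Binary.Construct.NonStrictToStrict as ToStrict
open import Relation.Binary.Definitions using (tri<; tri≈; tri>)
open import Relation.Binary.PropositionalEquality.Core as ≡ using (_≡_; _≢_)
import Relation.Binary.Reasoning.PartialOrder as PartialOrderReasoning
open import Relation.Binary.Structures using (IsDecTotalOrder)
open import Relation.Nullary using (¬_; Dec; yes; no; does; contradiction)
open import Relation.Unary using (Pred; U; ∁; _∩_; ⋃; _≐_; _⊥_; _⊆_)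

-- The expectation is the sum over the tuples k with sum n of the weight of k, the
-- product of p x = A x / (x + 1) over the distinct entries x of k.
--
-- Lower bound: the weight is at least the product over all entries, and in the
-- resulting h-fold convolution of p it suffices to let all entries but one be of
-- order n, where p is of order A n / n.
--
-- Upper bound: expanding over the coincidences among the entries bounds the sum
-- by finitely many convolutions of dilates of p.  A sequence f with
-- f n (n + 1) ≤ B and ∑ f ≤ B keeps these two properties, with B replaced by a
-- multiple of A N · B, when convolved with a dilate of p on [0, N]; this uses
-- ∑_{x ≤ N} p x = O(A N), which follows from a (2 n) = O(a n).

-- A repeated entry contributes its factor only once, so the weight is not a product over the
-- entries and the sum over tuples is not a convolution. If an entry x coincides with a later entry
-- y, then m x + m' y becomes (m + m') y. This is where the dilates come from, and why the upper
-- bound is proved by induction for all linear forms with positive coefficients. Merging keeps the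
-- total of the coefficients, so the constants depend on `h` alone.
--
-- Each new entry yields one factor A N, a repeated one none; since 1 ≤ A N for large N, the missing
-- power can be inserted. The upper bound is proved at a fixed N, because p x (x + 1) = A x ≤ A N is
-- uniform over x ≤ N only.
--
-- A(2x) = O(A(x)) serves the lower bound, through the comparison of A n with A at n/4; the
-- condition on the enumeration serves the upper bound, through the sum of p.

-- Arithmetic in an ordered field.

module OrderedField (ℝ : RealNumbers) where

  open RealNumbers ℝ
  open import Algebra.Properties.Ring ring using (-‿distribˡ-*; -‿involutive; -0#≈0#)
  open import Algebra.Properties.CommutativeSemiring.Exp commutativeSemiring public
    using (^-distrib-*; ^-congˡ)
  open import Algebra.Properties.Semiring.Mult semiring public
    using () renaming (×-homo-+ to ·-homo-+; ×1-homo-* to fromℕ-homo-*)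
  open import Algebra.Solver.Ring.NaturalCoefficients.Default commutativeSemiring public
    using (solve; _:+_; _:*_; _:=_; con)

  module ≤ = IsDecTotalOrder isDecTotalOrder

  ≤-poset : Poset _ _ _
  ≤-poset = record { isPartialOrder = ≤.isPartialOrder }

  module ≤-Reasoning = PartialOrderReasoning ≤-poset
  open ≤-Reasoning

  ≰⇒> : ∀ {x y} → ¬ x ≤ y → y < x
  ≰⇒> = ToStrict.≰⇒> _≈_ _≤_ sym ≤.reflexive ≤.total

  <⇒≱ : ∀ {x y} → x < y → ¬ y ≤ x
  <⇒≱ = ToStrict.<⇒≱ _≈_ _≤_ ≤.antisym

  +-mono-≤ : ∀ {x y u v} → x ≤ y → u ≤ v → x + u ≤ y + v
  +-mono-≤ {x} {y} {u} {v} x≤y u≤v = begin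
    x + u ≤⟨ +-monoˡ-≤ u x≤y ⟩
    y + u ≈⟨ +-comm y u ⟩
    u + y ≤⟨ +-monoˡ-≤ y u≤v ⟩
    v + y ≈⟨ +-comm v y ⟩
    y + v ∎

  +-nonneg : ∀ {x y} → 0# ≤ x → 0# ≤ y → 0# ≤ x + y
  +-nonneg {x} {y} 0≤x 0≤y = begin
    0#      ≈⟨ +-identityˡ 0# ⟨
    0# + 0# ≤⟨ +-mono-≤ 0≤x 0≤y ⟩
    x + y   ∎

  x≤x+y : ∀ {x y} → 0# ≤ y → x ≤ x + y
  x≤x+y {x} {y} 0≤y = begin
    x      ≈⟨ +-identityʳ x ⟨
    x + 0# ≤⟨ +-mono-≤ ≤.refl 0≤y ⟩
    x + y  ∎

  y≤x+y : ∀ {x y} → 0# ≤ x → y ≤ x + y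
  y≤x+y {x} {y} 0≤x = ≤.trans (x≤x+y 0≤x) (≤.reflexive (+-comm y x))

  x-y+y≈x : ∀ x y → (x - y) + y ≈ x
  x-y+y≈x x y = trans (+-assoc x (- y) y) (trans (+-congˡ (-‿inverseˡ y)) (+-identityʳ x))

  0≤y-x : ∀ {x y} → x ≤ y → 0# ≤ y - x
  0≤y-x {x} {y} x≤y = ≤.trans (≤.reflexive (sym (-‿inverseʳ x))) (+-monoˡ-≤ (- x) x≤y)

  y-x≤0⇒y≤x : ∀ {x y} → y - x ≤ 0# → y ≤ x
  y-x≤0⇒y≤x {x} {y} y-x≤0 = begin
    y         ≈⟨ x-y+y≈x y x ⟨
    y - x + x ≤⟨ +-monoˡ-≤ x y-x≤0 ⟩
    0# + x    ≈⟨ +-identityˡ x ⟩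
    x         ∎

  x≤0⇒0≤-x : ∀ {x} → x ≤ 0# → 0# ≤ - x
  x≤0⇒0≤-x {x} x≤0 = ≤.trans (0≤y-x x≤0) (≤.reflexive (+-identityˡ (- x)))

  *-monoˡ-≤ : ∀ {x y} z → 0# ≤ z → x ≤ y → z * x ≤ z * y
  *-monoˡ-≤ {x} {y} z 0≤z x≤y = begin
    z * x               ≤⟨ y≤x+y (*-nonneg 0≤z (0≤y-x x≤y)) ⟩
    z * (y - x) + z * x ≈⟨ distribˡ z (y - x) x ⟨
    z * (y - x + x)     ≈⟨ *-congˡ (x-y+y≈x y x) ⟩
    z * y               ∎

  *-monoʳ-≤ : ∀ {x y} z → 0# ≤ z → x ≤ y → x * z ≤ y * z
  *-monoʳ-≤ {x} {y} z 0≤z x≤y = begin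
    x * z ≈⟨ *-comm x z ⟩
    z * x ≤⟨ *-monoˡ-≤ z 0≤z x≤y ⟩
    z * y ≈⟨ *-comm z y ⟩
    y * z ∎

  *-mono-≤ : ∀ {x y u v} → 0# ≤ y → 0# ≤ u → x ≤ y → u ≤ v → x * u ≤ y * v
  *-mono-≤ 0≤y 0≤u x≤y u≤v = ≤.trans (*-monoʳ-≤ _ 0≤u x≤y) (*-monoˡ-≤ _ 0≤y u≤v)

  0≤1 : 0# ≤ 1#
  0≤1 with ≤.total 0# 1#
  ... | inj₁ 0≤1 = 0≤1
  ... | inj₂ 1≤0 = begin
    0#           ≤⟨ *-nonneg (x≤0⇒0≤-x 1≤0) (x≤0⇒0≤-x 1≤0) ⟩
    - 1# * - 1#  ≈⟨ -‿distribˡ-* 1# (- 1#) ⟨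
    - (1# * - 1#) ≈⟨ -‿cong (*-identityˡ (- 1#)) ⟩
    - - 1#       ≈⟨ -‿involutive 1# ⟩
    1#           ∎

  ^-nonneg : ∀ {x} n → 0# ≤ x → 0# ≤ x ^ n
  ^-nonneg zero    0≤x = 0≤1
  ^-nonneg (suc n) 0≤x = *-nonneg 0≤x (^-nonneg n 0≤x)

  ^-mono-≤ : ∀ {x y} n → 0# ≤ x → x ≤ y → x ^ n ≤ y ^ n
  ^-mono-≤ zero    0≤x x≤y = ≤.refl
  ^-mono-≤ (suc n) 0≤x x≤y = *-mono-≤ (≤.trans 0≤x x≤y) (^-nonneg n 0≤x) x≤y (^-mono-≤ n 0≤x x≤y)

  fromℕ-homo-+ : ∀ m n → fromℕ (m ℕ.+ n) ≈ fromℕ m + fromℕ n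
  fromℕ-homo-+ m n = ·-homo-+ 1# m n

  fromℕ-nonneg : ∀ n → 0# ≤ fromℕ n
  fromℕ-nonneg zero    = ≤.refl
  fromℕ-nonneg (suc n) = +-nonneg 0≤1 (fromℕ-nonneg n)

  fromℕ-mono-≤ : ∀ {m n} → m ℕ.≤ n → fromℕ m ≤ fromℕ n
  fromℕ-mono-≤ {n = n} z≤n = fromℕ-nonneg n
  fromℕ-mono-≤ (s≤s m≤n)     = +-mono-≤ ≤.refl (fromℕ-mono-≤ m≤n)

  1≤fromℕ-suc : ∀ n → 1# ≤ fromℕ (suc n)
  1≤fromℕ-suc n = x≤x+y (fromℕ-nonneg n)

  fromℕ-suc>0 : ∀ n → 0# < fromℕ (suc n)
  fromℕ-suc>0 n = fromℕ-nonneg (suc n) ,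
    λ 0≈ → 0≉1 (≤.antisym 0≤1 (≤.trans (1≤fromℕ-suc n) (≤.reflexive (sym 0≈))))

  >0⇒≉0 : ∀ {x} → 0# < x → ¬ x ≈ 0#
  >0⇒≉0 (_ , 0≉x) x≈0 = 0≉x (sym x≈0)

  ⁻¹-nonneg : ∀ {x} → 0# < x → 0# ≤ x ⁻¹
  ⁻¹-nonneg {x} 0<x@(0≤x , _) with ≤.total 0# (x ⁻¹)
  ... | inj₁ 0≤x⁻¹ = 0≤x⁻¹
  ... | inj₂ x⁻¹≤0 = contradiction (≤.antisym 0≤1 1≤0) 0≉1
    where
    1≤0 : 1# ≤ 0#
    1≤0 = begin
      1#       ≈⟨ ⁻¹-inverseʳ (>0⇒≉0 0<x) ⟨
      x * x ⁻¹ ≤⟨ *-monoˡ-≤ x 0≤x x⁻¹≤0 ⟩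
      x * 0#   ≈⟨ zeroʳ x ⟩
      0#       ∎

  x/y*y≈x : ∀ x {y} → 0# < y → x / y * y ≈ x
  x/y*y≈x x {y} 0<y = begin-equality
    x * y ⁻¹ * y   ≈⟨ solve 3 (λ x y z → x :* y :* z := x :* (z :* y)) refl x (y ⁻¹) y ⟩
    x * (y * y ⁻¹) ≈⟨ *-congˡ (⁻¹-inverseʳ (>0⇒≉0 0<y)) ⟩
    x * 1#         ≈⟨ *-identityʳ x ⟩
    x              ∎

  *-cancelʳ-≤ : ∀ {x y z} → 0# < z → x * z ≤ y * z → x ≤ y
  *-cancelʳ-≤ {x} {y} {z} 0<z xz≤yz = begin
    x              ≈⟨ xzz⁻¹≈x x ⟨
    x * z * z ⁻¹   ≤⟨ *-monoʳ-≤ (z ⁻¹) (⁻¹-nonneg 0<z) xz≤yz ⟩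
    y * z * z ⁻¹   ≈⟨ xzz⁻¹≈x y ⟩
    y              ∎
    where
    xzz⁻¹≈x : ∀ x → x * z * z ⁻¹ ≈ x
    xzz⁻¹≈x x = trans (*-assoc x z (z ⁻¹)) (trans (*-congˡ (⁻¹-inverseʳ (>0⇒≉0 0<z))) (*-identityʳ x))

  x≤y/z : ∀ {x y z} → 0# < z → x * z ≤ y → x ≤ y / z
  x≤y/z {y = y} 0<z xz≤y = *-cancelʳ-≤ 0<z (≤.trans xz≤y (≤.reflexive (sym (x/y*y≈x y 0<z))))

  x/z≤y : ∀ {x y z} → 0# < z → x ≤ y * z → x / z ≤ y
  x/z≤y {x} 0<z x≤yz = *-cancelʳ-≤ 0<z (≤.trans (≤.reflexive (x/y*y≈x x 0<z)) x≤yz)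

  -- Brings bounds stated over the field back to ℕ; it rests on n < n + 1, that is, on `0≉1`.
  fromℕ-cancel-≤ : ∀ {m n} → fromℕ m ≤ fromℕ n → m ℕ.≤ n
  fromℕ-cancel-≤ {m} {n} fm≤fn with m ℕ.≤? n
  ... | yes m≤n = m≤n
  ... | no  m≰n = contradiction (≤.trans (fromℕ-mono-≤ (ℕ.≰⇒> m≰n)) fm≤fn) (<⇒≱ n<1+n)
    where
    n<1+n : fromℕ n < 1# + fromℕ n
    n<1+n = y≤x+y 0≤1 , λ n≈1+n → 0≉1 (begin-equality
      0#                       ≈⟨ -‿inverseʳ (fromℕ n) ⟨
      fromℕ n - fromℕ n        ≈⟨ +-congʳ n≈1+n ⟩
      1# + fromℕ n - fromℕ n   ≈⟨ +-assoc 1# _ _ ⟩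
      1# + (fromℕ n - fromℕ n) ≈⟨ +-congˡ (-‿inverseʳ (fromℕ n)) ⟩
      1# + 0#                  ≈⟨ +-identityʳ 1# ⟩
      1#                       ∎)

  -- Absolute values and limits.

  ∣x∣≡x : ∀ {x} → 0# ≤ x → ∣ x ∣ ≡ x
  ∣x∣≡x {x} 0≤x with 0# ≤? x
  ... | yes _   = ≡.refl
  ... | no  0≰x = contradiction 0≤x 0≰x

  x≤∣x∣ : ∀ x → x ≤ ∣ x ∣
  x≤∣x∣ x with 0# ≤? x
  ... | yes _   = ≤.refl
  ... | no  0≰x = ≤.trans (proj₁ (≰⇒> 0≰x)) (x≤0⇒0≤-x (proj₁ (≰⇒> 0≰x)))

  -x≤∣x∣ : ∀ x → - x ≤ ∣ x ∣
  -x≤∣x∣ x with 0# ≤? x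
  ... | no  _   = ≤.refl
  ... | yes 0≤x = ≤.trans -x≤0 0≤x
    where
    -x≤0 : - x ≤ 0#
    -x≤0 = ≤.trans (y≤x+y 0≤x) (≤.reflexive (-‿inverseʳ x))

  -- For positive x, the choice ε = x / 2 would give x + x ≤ x.
  ∀ε⇒≤0 : ∀ {x} → (∀ ε → 0# < ε → x ≤ ε) → x ≤ 0#
  ∀ε⇒≤0 {x} x≤ε with x ≤? 0#
  ... | yes x≤0 = x≤0
  ... | no  x≰0 = contradiction x≤0 x≰0
    where
    two = fromℕ 2
    0<x = ≰⇒> x≰0

    half-pos : 0# < x / two
    half-pos = *-nonneg (proj₁ 0<x) (⁻¹-nonneg (fromℕ-suc>0 1)) , λ 0≈h → proj₂ 0<x
      (trans (sym (zeroˡ two)) (trans (*-congʳ 0≈h) (x/y*y≈x x (fromℕ-suc>0 1))))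

    x+x≤x : x + x ≤ x
    x+x≤x = begin
      x + x         ≈⟨ solve 1 (λ x → x :+ x := x :* (con 1 :+ (con 1 :+ con 0))) refl x ⟩
      x * two       ≤⟨ *-monoʳ-≤ two (fromℕ-nonneg 2) (x≤ε _ half-pos) ⟩
      x / two * two ≈⟨ x/y*y≈x x (fromℕ-suc>0 1) ⟩
      x             ∎

    x≤0 : x ≤ 0#
    x≤0 = begin
      x           ≈⟨ +-identityʳ x ⟨
      x + 0#      ≈⟨ +-congˡ (-‿inverseʳ x) ⟨
      x + (x - x) ≈⟨ +-assoc x x (- x) ⟨
      x + x - x   ≤⟨ +-monoˡ-≤ (- x) x+x≤x ⟩
      x - x       ≈⟨ -‿inverseʳ x ⟩
      0#          ∎

  eventually-constant⇒converges : ∀ {s c} N → (∀ n → N ℕ.≤ n → s n ≈ c) → s ConvergesTo c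
  eventually-constant⇒converges {s} {c} N s≈c ε (0≤ε , _) = N , λ n N≤n →
    ≤.trans (close (trans (+-congʳ (s≈c n N≤n)) (-‿inverseʳ c))) 0≤ε
    where
    close : ∀ {x} → x ≈ 0# → ∣ x ∣ ≤ 0#
    close {x} x≈0 with 0# ≤? x
    ... | yes _ = ≤.reflexive x≈0
    ... | no  _ = ≤.reflexive (trans (-‿cong x≈0) -0#≈0#)

  -- Both c - x and x - c lie below |c - x|, hence below every positive ε. This turns countable
  -- additivity into finite additivity.
  limit-of-eventually-constant : ∀ {s c x} N → (∀ n → N ℕ.≤ n → s n ≈ c) → s ConvergesTo x → x ≈ c
  limit-of-eventually-constant {s} {c} {x} N s≈c s→x = ≤.antisym
    (y-x≤0⇒y≤x (∀ε⇒≤0 λ ε 0<ε → ≤.trans (≤.reflexive (sym -[c-x])) (≤.trans (-x≤∣x∣ (c - x)) (bound ε 0<ε))))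
    (y-x≤0⇒y≤x (∀ε⇒≤0 λ ε 0<ε → ≤.trans (x≤∣x∣ (c - x)) (bound ε 0<ε)))
    where
    -[c-x] : - (c - x) ≈ x - c
    -[c-x] = begin-equality
      - (c - x)           ≈⟨ +-identityˡ _ ⟨
      0# - (c - x)        ≈⟨ +-congʳ (-‿inverseʳ x) ⟨
      x - x - (c - x)
        ≈⟨ +-congʳ (+-congˡ (trans (sym (+-identityˡ _)) (+-congʳ (sym (-‿inverseˡ c))))) ⟩
      x + (- c + c - x) - (c - x)   ≈⟨ +-congʳ (+-congˡ (+-assoc (- c) c (- x))) ⟩
      x + (- c + (c - x)) - (c - x) ≈⟨ +-congʳ (+-assoc x (- c) (c - x)) ⟨
      x - c + (c - x) - (c - x)     ≈⟨ +-assoc (x - c) _ _ ⟩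
      x - c + (c - x - (c - x))     ≈⟨ +-congˡ (-‿inverseʳ (c - x)) ⟩
      x - c + 0#          ≈⟨ +-identityʳ _ ⟩
      x - c               ∎

    abs-cong : ∀ {y z} → y ≈ z → ∣ y ∣ ≤ ∣ z ∣
    abs-cong {y} {z} y≈z with 0# ≤? y
    ... | yes _ = ≤.trans (≤.reflexive y≈z) (x≤∣x∣ z)
    ... | no  _ = ≤.trans (≤.reflexive (-‿cong y≈z)) (-x≤∣x∣ z)

    bound : ∀ ε → 0# < ε → ∣ c - x ∣ ≤ ε
    bound ε 0<ε with s→x ε 0<ε
    ... | M , close = ≤.trans (abs-cong (+-congʳ (sym (s≈c (N ℕ.+ M) (ℕ.m≤m+n N M)))))
                              (close (N ℕ.+ M) (ℕ.m≤n+m M N))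

  -- Finite sums.

  ∑ : ∀ {X : Set} → List X → (X → Carrier) → Carrier
  ∑ []       f = 0#
  ∑ (x ∷ xs) f = f x + ∑ xs f

  module _ {X : Set} where

    ∑-cong : ∀ (xs : List X) {f g} → (∀ x → f x ≈ g x) → ∑ xs f ≈ ∑ xs g
    ∑-cong []       f≈g = refl
    ∑-cong (x ∷ xs) f≈g = +-cong (f≈g x) (∑-cong xs f≈g)

    ∑-mono-≤ : ∀ (xs : List X) {f g} → (∀ x → f x ≤ g x) → ∑ xs f ≤ ∑ xs g
    ∑-mono-≤ []       f≤g = ≤.refl
    ∑-mono-≤ (x ∷ xs) f≤g = +-mono-≤ (f≤g x) (∑-mono-≤ xs f≤g)

    ∑-0 : ∀ (xs : List X) → ∑ xs (λ _ → 0#) ≈ 0#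
    ∑-0 []       = refl
    ∑-0 (x ∷ xs) = trans (+-identityˡ _) (∑-0 xs)

    ∑-nonneg : ∀ (xs : List X) {f} → (∀ x → 0# ≤ f x) → 0# ≤ ∑ xs f
    ∑-nonneg []       0≤f = ≤.refl
    ∑-nonneg (x ∷ xs) 0≤f = +-nonneg (0≤f x) (∑-nonneg xs 0≤f)

    ∑-+ : ∀ (xs : List X) f g → ∑ xs (λ x → f x + g x) ≈ ∑ xs f + ∑ xs g
    ∑-+ []       f g = sym (+-identityˡ 0#)
    ∑-+ (x ∷ xs) f g = trans (+-congˡ (∑-+ xs f g))
      (solve 4 (λ a b c d → a :+ b :+ (c :+ d) := a :+ c :+ (b :+ d)) refl (f x) (g x) _ _)

    ∑-*ˡ : ∀ (xs : List X) c f → ∑ xs (λ x → c * f x) ≈ c * ∑ xs f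
    ∑-*ˡ []       c f = sym (zeroʳ c)
    ∑-*ˡ (x ∷ xs) c f = trans (+-congˡ (∑-*ˡ xs c f)) (sym (distribˡ c (f x) _))

    ∑-*ʳ : ∀ (xs : List X) c f → ∑ xs (λ x → f x * c) ≈ ∑ xs f * c
    ∑-*ʳ xs c f = trans (∑-cong xs λ x → *-comm (f x) c) (trans (∑-*ˡ xs c f) (*-comm c _))

    ∑-const : ∀ (xs : List X) c → ∑ xs (λ _ → c) ≈ fromℕ (length xs) * c
    ∑-const []       c = sym (zeroˡ c)
    ∑-const (x ∷ xs) c = trans (+-congˡ (∑-const xs c))
      (solve 2 (λ c n → c :+ n :* c := (con 1 :+ n) :* c) refl c (fromℕ (length xs)))

    ∑-++ : ∀ (xs ys : List X) f → ∑ (xs ++ ys) f ≈ ∑ xs f + ∑ ys f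
    ∑-++ []       ys f = sym (+-identityˡ _)
    ∑-++ (x ∷ xs) ys f = trans (+-congˡ (∑-++ xs ys f)) (sym (+-assoc (f x) _ _))

    ∑-map : ∀ {Y : Set} (g : Y → X) ys f → ∑ (map g ys) f ≡ ∑ ys (f ∘ g)
    ∑-map g []       f = ≡.refl
    ∑-map g (y ∷ ys) f = ≡.cong (f (g y) +_) (∑-map g ys f)

    ∑-member : ∀ {xs : List X} {f x} → (∀ x → 0# ≤ f x) → x List.∈ xs → f x ≤ ∑ xs f
    ∑-member {_ ∷ xs} 0≤f (here ≡.refl) = x≤x+y (∑-nonneg xs 0≤f)
    ∑-member {x ∷ xs} 0≤f (there x∈xs)  = ≤.trans (∑-member 0≤f x∈xs) (y≤x+y (0≤f x))

  ∑-swap : ∀ {X Y : Set} (xs : List X) (ys : List Y) (f : X → Y → Carrier) →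
           ∑ xs (λ x → ∑ ys (f x)) ≈ ∑ ys (λ y → ∑ xs (λ x → f x y))
  ∑-swap []       ys f = sym (∑-0 ys)
  ∑-swap (x ∷ xs) ys f = trans (+-congˡ (∑-swap xs ys f)) (sym (∑-+ ys (f x) _))

  ∑-cartesianProductWith : ∀ {X Y Z : Set} (g : X → Y → Z) xs ys f →
    ∑ (cartesianProductWith g xs ys) f ≈ ∑ xs (λ x → ∑ ys (λ y → f (g x y)))
  ∑-cartesianProductWith g []       ys f = refl
  ∑-cartesianProductWith g (x ∷ xs) ys f = begin-equality
    ∑ (map (g x) ys ++ cartesianProductWith g xs ys) f        ≈⟨ ∑-++ (map (g x) ys) _ f ⟩
    ∑ (map (g x) ys) f + ∑ (cartesianProductWith g xs ys) f
      ≈⟨ +-cong (reflexive (∑-map (g x) ys f)) (∑-cartesianProductWith g xs ys f) ⟩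
    ∑ ys (f ∘ g x) + ∑ xs (λ x → ∑ ys (λ y → f (g x y)))      ∎

  ∑-box : ∀ h n (f : Vec ℕ (suc h) → Carrier) →
          ∑ (box (suc h) n) f ≈ ∑ (upTo (suc n)) (λ x → ∑ (box h n) (λ k → f (x Vec.∷ k)))
  ∑-box h n = ∑-cartesianProductWith Vec._∷_ (upTo (suc n)) (box h n)

  ∑-upTo-suc : ∀ n f → ∑ (upTo (suc n)) f ≡ f 0 + ∑ (upTo n) (f ∘ suc)
  ∑-upTo-suc n f = ≡.cong (f 0 +_)
    (≡.trans (≡.cong (λ xs → ∑ xs f) (≡.sym (List.map-applyUpTo (λ x → x) suc n))) (∑-map suc (upTo n) f))

  ∑-upTo-+ : ∀ m n f → ∑ (upTo (m ℕ.+ n)) f ≈ ∑ (upTo m) f + ∑ (upTo n) (λ i → f (m ℕ.+ i))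
  ∑-upTo-+ zero    n f = sym (+-identityˡ _)
  ∑-upTo-+ (suc m) n f = begin-equality
    ∑ (upTo (suc (m ℕ.+ n))) f                     ≡⟨ ∑-upTo-suc (m ℕ.+ n) f ⟩
    f 0 + ∑ (upTo (m ℕ.+ n)) (f ∘ suc)             ≈⟨ +-congˡ (∑-upTo-+ m n (f ∘ suc)) ⟩
    f 0 + (∑ (upTo m) (f ∘ suc) + ∑ (upTo n) tail) ≈⟨ +-assoc (f 0) _ _ ⟨
    f 0 + ∑ (upTo m) (f ∘ suc) + ∑ (upTo n) tail   ≡⟨ ≡.cong (_+ ∑ (upTo n) tail) (∑-upTo-suc m f) ⟨
    ∑ (upTo (suc m)) f + ∑ (upTo n) tail           ∎
    where
    tail : ℕ → Carrier
    tail i = f (suc m ℕ.+ i)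

  ∑-upTo-mono-≤ : ∀ {m n} {f : ℕ → Carrier} → (∀ i → 0# ≤ f i) → m ℕ.≤ n → ∑ (upTo m) f ≤ ∑ (upTo n) f
  ∑-upTo-mono-≤ {m} {n} {f} 0≤f m≤n = begin
    ∑ (upTo m) f
      ≤⟨ x≤x+y (∑-nonneg (upTo (n ℕ.∸ m)) (λ i → 0≤f (m ℕ.+ i))) ⟩
    ∑ (upTo m) f + ∑ (upTo (n ℕ.∸ m)) (λ i → f (m ℕ.+ i))  ≈⟨ ∑-upTo-+ m (n ℕ.∸ m) f ⟨
    ∑ (upTo (m ℕ.+ (n ℕ.∸ m))) f
      ≡⟨ ≡.cong (λ k → ∑ (upTo k) f) (ℕ.m+[n∸m]≡n m≤n) ⟩
    ∑ (upTo n) f                                           ∎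

  ∑-upTo-mono-< : ∀ n {f g : ℕ → Carrier} → (∀ i → i ℕ.< n → f i ≤ g i) → ∑ (upTo n) f ≤ ∑ (upTo n) g
  ∑-upTo-mono-< zero    f≤g = ≤.refl
  ∑-upTo-mono-< (suc n) {f} {g} f≤g = begin
    ∑ (upTo (suc n)) f         ≡⟨ ∑-upTo-suc n f ⟩
    f 0 + ∑ (upTo n) (f ∘ suc)
      ≤⟨ +-mono-≤ (f≤g 0 (s≤s z≤n)) (∑-upTo-mono-< n (λ i i<n → f≤g (suc i) (s≤s i<n))) ⟩
    g 0 + ∑ (upTo n) (g ∘ suc) ≡⟨ ∑-upTo-suc n g ⟨
    ∑ (upTo (suc n)) g         ∎

  ∑-upTo-const : ∀ n c → ∑ (upTo n) (λ _ → c) ≈ fromℕ n * c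
  ∑-upTo-const n c = trans (∑-const (upTo n) c) (*-congʳ (reflexive (≡.cong fromℕ (List.length-upTo n))))

-- Finite additivity and the expectation of a counting variable.

module MeasureTheory (ℝ : RealNumbers) {Ω I : Set} {G : I → Pred Ω 0ℓ}
                     (μ : Probability.ProbabilityMeasure ℝ G) where

  open RealNumbers ℝ
  open Probability ℝ
  open OrderedField ℝ
  open ≤-Reasoning
  open ProbabilityMeasure μ

  -- Excluded middle is not assumed, so an event can be cut along another one only where membership
  -- in the latter is decidable.
  Decidable : Pred Ω 0ℓ → Set
  Decidable E = ∀ ω → Dec (E ω)

  ∅-generated : Generated G (∁ U)
  ∅-generated = complement whole

  ∑<-0 : ∀ n f → (∀ i → f i ≈ 0#) → ∑< n f ≈ 0#
  ∑<-0 zero    f f≈0 = refl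
  ∑<-0 (suc n) f f≈0 = trans (+-cong (f≈0 0) (∑<-0 n (f ∘ suc) (f≈0 ∘ suc))) (+-identityˡ 0#)

  ∑<-nonneg : ∀ n f → (∀ i → 0# ≤ f i) → 0# ≤ ∑< n f
  ∑<-nonneg zero    f 0≤f = ≤.refl
  ∑<-nonneg (suc n) f 0≤f = +-nonneg (0≤f 0) (∑<-nonneg n (f ∘ suc) (0≤f ∘ suc))

  -- Since ∅ is a countable disjoint union of copies of itself, the partial sums
  -- n · Pr ∅ converge to Pr ∅.
  Pr-∅ : Pr ∅-generated ≈ 0#
  Pr-∅ = ≤.antisym (∀ε⇒≤0 z≤ε) 0≤z
    where
    z   = Pr ∅-generated
    0≤z = Pr-nonneg ∅-generated

    ⋃∅-generated : Generated G (⋃ ℕ (λ _ → ∁ U))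
    ⋃∅-generated = union (λ _ → ∅-generated)

    Pr-⋃∅≈z : Pr ⋃∅-generated ≈ z
    Pr-⋃∅≈z = Pr-cong _ _ ((λ (_ , x∈∅) → x∈∅) , λ x∈∅ → 0 , x∈∅)

    z≤ε : ∀ ε → 0# < ε → z ≤ ε
    z≤ε ε 0<ε with Pr-union (λ _ → ∅-generated) (λ _ _ _ (x∈∅ , _) → x∈∅ tt) ε 0<ε
    -- With 2 + N terms the partial sum is z + (z + s). Subtracting the limit, which is again z,
    -- leaves s + z.
    ... | N , close = begin
      z                     ≤⟨ y≤x+y (∑<-nonneg N (λ _ → z) (λ _ → 0≤z)) ⟩
      s + z                 ≈⟨ +-identityʳ _ ⟨
      s + z + 0#            ≈⟨ +-congˡ (-‿inverseʳ l) ⟨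
      s + z + (l - l)       ≈⟨ +-congˡ (+-congʳ Pr-⋃∅≈z) ⟩
      s + z + (z - l)       ≈⟨ +-assoc (s + z) z (- l) ⟨
      s + z + z - l         ≈⟨ +-congʳ (solve 2 (λ s z → s :+ z :+ z := z :+ (z :+ s)) refl s z) ⟩
      z + (z + s) - l       ≤⟨ x≤∣x∣ _ ⟩
      ∣ z + (z + s) - l ∣   ≤⟨ close (2 ℕ.+ N) (ℕ.m≤n+m N 2) ⟩
      ε                     ∎
      where
      s = ∑< N (λ _ → z)
      l = Pr ⋃∅-generated

  Pr-empty : ∀ {E} (e : Generated G E) → (∀ ω → ¬ E ω) → Pr e ≈ 0#
  Pr-empty e ¬E = trans (Pr-cong e ∅-generated ((λ {ω} Eω → ⊥-elim (¬E ω Eω)) , λ ω∈∅ → ⊥-elim (ω∈∅ tt))) Pr-∅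

  module _ {E F : Pred Ω 0ℓ} where

    -- Two events padded with empty ones: the measure is additive over sequences of events, and
    -- `Pr-∅` removes the padding.
    pair : ℕ → Pred Ω 0ℓ
    pair 0             = E
    pair 1             = F
    pair (suc (suc _)) = ∁ U

    module _ (e : Generated G E) (f : Generated G F) where

      pair-generated : ∀ i → Generated G (pair i)
      pair-generated 0             = e
      pair-generated 1             = f
      pair-generated (suc (suc _)) = ∅-generated

      Pr-⊎ : E ⊥ F → Pr (union pair-generated) ≈ Pr e + Pr f
      Pr-⊎ E⊥F = limit-of-eventually-constant 2 eventually (Pr-union pair-generated disjoint)
        where
        disjoint : ∀ i j → i ≢ j → pair i ⊥ pair j
        disjoint 0             0             i≢j _         = i≢j ≡.refl
        disjoint 0             1             _   x         = E⊥F x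
        disjoint 1             0             _   (x , y)   = E⊥F (y , x)
        disjoint 1             1             i≢j _         = i≢j ≡.refl
        disjoint (suc (suc _)) _             _   (x∈∅ , _) = x∈∅ tt
        disjoint 0             (suc (suc _)) _   (_ , x∈∅) = x∈∅ tt
        disjoint 1             (suc (suc _)) _   (_ , x∈∅) = x∈∅ tt

        eventually : ∀ n → 2 ℕ.≤ n → ∑< n (λ i → Pr (pair-generated i)) ≈ Pr e + Pr f
        eventually (suc (suc n)) _ = begin-equality
          Pr e + (Pr f + ∑< n (λ _ → Pr ∅-generated)) ≈⟨ +-congˡ (+-congˡ (∑<-0 n _ (λ _ → Pr-∅))) ⟩
          Pr e + (Pr f + 0#)                          ≈⟨ +-congˡ (+-identityʳ _) ⟩
          Pr e + Pr f                                 ∎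
        eventually 1 (s≤s ())

  Pr-split : ∀ {E F} (e : Generated G E) (f : Generated G F) → Decidable F →
             Pr e ≈ Pr (intersection e f) + Pr (intersection e (complement f))
  Pr-split {E} {F} e f F? = trans (Pr-cong e (union D) (split , join))
                                  (Pr-⊎ _ _ (λ ((_ , y) , (_ , ¬y)) → ¬y y))
    where
    D = pair-generated (intersection e f) (intersection e (complement f))

    split : E ⊆ ⋃ ℕ (pair {E ∩ F} {E ∩ ∁ F})
    split {ω} Eω with F? ω
    ... | yes Fω = 0 , Eω , Fω
    ... | no ¬Fω = 1 , Eω , ¬Fω

    join : ⋃ ℕ (pair {E ∩ F} {E ∩ ∁ F}) ⊆ E
    join (0 , Eω , _)           = Eω
    join (1 , Eω , _)           = Eω
    join (suc (suc _) , ω∈∅)    = ⊥-elim (ω∈∅ tt)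

  module Counting {X : Set} (P : X → Pred Ω 0ℓ) (P? : ∀ x → Decidable (P x))
                  (P-generated : ∀ x → Generated G (P x)) where

    # : List X → Ω → ℕ
    # xs ω = length (filter (λ x → P? x ω) xs)

    -- Splitting on whether the first event occurs reduces the value v for `x ∷ xs` to the values v
    -- - 1 and v for `xs`.
    #-generated : ∀ xs v → Generated G (λ ω → # xs ω ≡ v)
    #-generated []       zero    = respects ((λ _ → ≡.refl) , (λ _ → tt)) whole
    #-generated []       (suc v) = respects ((λ ω∈∅ → ⊥-elim (ω∈∅ tt)) , (λ ())) ∅-generated
    #-generated (x ∷ xs) v       = respects (join , split) (union (pair-generated (hit v) miss))
      where
      Hit : ℕ → Pred Ω 0ℓ
      Hit v = P x ∩ (λ ω → suc (# xs ω) ≡ v)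

      hit : ∀ v → Generated G (Hit v)
      hit zero    = respects ((λ ω∈∅ → ⊥-elim (ω∈∅ tt)) , (λ ())) ∅-generated
      hit (suc v) = intersection (P-generated x)
        (respects (≡.cong suc , ℕ.suc-injective) (#-generated xs v))

      miss : Generated G (∁ (P x) ∩ (λ ω → # xs ω ≡ v))
      miss = intersection (complement (P-generated x)) (#-generated xs v)

      join : ⋃ ℕ (pair {Hit v} {∁ (P x) ∩ (λ ω → # xs ω ≡ v)}) ⊆ (λ ω → # (x ∷ xs) ω ≡ v)
      join {ω} i∈ with P? x ω
      join (0 , _ , eq)          | yes _  = eq
      join (1 , ¬p , _)          | yes p  = contradiction p ¬p
      join (0 , p , _)           | no  ¬p = contradiction p ¬p
      join (1 , _ , eq)          | no  _  = eq
      join (suc (suc _) , ω∈∅)   | yes _  = ⊥-elim (ω∈∅ tt)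
      join (suc (suc _) , ω∈∅)   | no  _  = ⊥-elim (ω∈∅ tt)

      split : (λ ω → # (x ∷ xs) ω ≡ v) ⊆ ⋃ ℕ (pair {Hit v} {∁ (P x) ∩ (λ ω → # xs ω ≡ v)})
      split {ω} eq with P? x ω
      ... | yes p = 0 , p , eq
      ... | no ¬p = 1 , ¬p , eq

    -- The event E and the offset c make the induction on the list go through:
    -- conditioning on the first event replaces E by E ∩ P x and c by suc c.
    ∑-value-Pr : ∀ xs {E} (e : Generated G E) c n → length xs ℕ.< n →
      ∑ (upTo n) (λ v → fromℕ (c ℕ.+ v) * Pr (intersection e (#-generated xs v)))
        ≈ fromℕ c * Pr e + ∑ xs (λ x → Pr (intersection e (P-generated x)))
    ∑-value-Pr [] e c (suc n) _ = begin-equality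
      ∑ (upTo (suc n)) term          ≡⟨ ∑-upTo-suc n term ⟩
      term 0 + ∑ (upTo n) (term ∘ suc)
        ≈⟨ +-cong (*-cong (reflexive (≡.cong fromℕ (ℕ.+-identityʳ c))) (Pr-cong _ e (proj₁ , λ x → x , ≡.refl)))
                  (trans (∑-cong (upTo n) λ v → trans (*-congˡ (Pr-empty _ (λ _ ()))) (zeroʳ _)) (∑-0 (upTo n))) ⟩
      fromℕ c * Pr e + 0#            ∎
      where
      term : ℕ → Carrier
      term v = fromℕ (c ℕ.+ v) * Pr (intersection e (#-generated [] v))
    ∑-value-Pr (x ∷ xs) {E} e c (suc n) (s≤s len<n) = begin-equality
      ∑ (upTo (suc n)) (λ v → fromℕ (c ℕ.+ v) * Pr (intersection e (#-generated (x ∷ xs) v)))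
        ≈⟨ ∑-cong (upTo (suc n)) (λ v → trans (*-congˡ (Pr-# v)) (distribˡ _ (Hit v) (Miss v))) ⟩
      ∑ (upTo (suc n)) (λ v → fromℕ (c ℕ.+ v) * Hit v + fromℕ (c ℕ.+ v) * Miss v)
        ≈⟨ ∑-+ (upTo (suc n)) _ _ ⟩
      ∑ (upTo (suc n)) (λ v → fromℕ (c ℕ.+ v) * Hit v) + ∑ (upTo (suc n)) (λ v → fromℕ (c ℕ.+ v) * Miss v)
        ≈⟨ +-cong hits (∑-value-Pr xs e∁ c (suc n) (ℕ.m<n⇒m<1+n len<n)) ⟩
      (1# + fromℕ c) * Pr eP + ∑ xs (λ y → Pr (intersection eP (P-generated y)))
        + (fromℕ c * Pr e∁ + ∑ xs (λ y → Pr (intersection e∁ (P-generated y))))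
        ≈⟨ solve 5 (λ c p s q t → (con 1 :+ c) :* p :+ s :+ (c :* q :+ t) := c :* (p :+ q) :+ (p :+ (s :+ t)))
             refl (fromℕ c) (Pr eP) _ (Pr e∁) _ ⟩
      fromℕ c * (Pr eP + Pr e∁) + (Pr eP + (∑ xs (λ y → Pr (intersection eP (P-generated y)))
                                           + ∑ xs (λ y → Pr (intersection e∁ (P-generated y)))))
        ≈⟨ +-cong (*-congˡ (sym (Pr-split e (P-generated x) (P? x))))
                  (+-congˡ (trans (sym (∑-+ xs _ _)) (∑-cong xs (λ y → sym (Pr-split-∩ y))))) ⟩
      fromℕ c * Pr e + (Pr eP + ∑ xs (λ y → Pr (intersection e (P-generated y))))
        ∎
      where
      eP = intersection e (P-generated x)
      e∁ = intersection e (complement (P-generated x))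

      hit-generated : ∀ v → Generated G ((E ∩ (λ ω → # (x ∷ xs) ω ≡ v)) ∩ P x)
      hit-generated v = intersection (intersection e (#-generated (x ∷ xs) v)) (P-generated x)

      Hit Miss : ℕ → Carrier
      Hit  v = Pr (hit-generated v)
      Miss v = Pr (intersection e∁ (#-generated xs v))

      Pr-# : ∀ v → Pr (intersection e (#-generated (x ∷ xs) v)) ≈ Hit v + Miss v
      Pr-# v = trans (Pr-split _ (P-generated x) (P? x)) (+-congˡ (Pr-cong _ _ (to , from)))
        where
        to : ((E ∩ (λ ω → # (x ∷ xs) ω ≡ v)) ∩ ∁ (P x)) ⊆ ((E ∩ ∁ (P x)) ∩ (λ ω → # xs ω ≡ v))
        to {ω} ((Eω , eq) , ¬p) with P? x ω
        ... | yes p = contradiction p ¬p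
        ... | no  _ = (Eω , ¬p) , eq

        from : ((E ∩ ∁ (P x)) ∩ (λ ω → # xs ω ≡ v)) ⊆ ((E ∩ (λ ω → # (x ∷ xs) ω ≡ v)) ∩ ∁ (P x))
        from {ω} ((Eω , ¬p) , eq) with P? x ω
        ... | yes p = contradiction p ¬p
        ... | no  _ = (Eω , eq) , ¬p

      Hit-zero : Hit 0 ≈ 0#
      Hit-zero = Pr-empty (hit-generated 0) empty
        where
        empty : ∀ ω → ¬ ((E ∩ (λ ω → # (x ∷ xs) ω ≡ 0)) ∩ P x) ω
        empty ω ((_ , eq) , p) with P? x ω
        empty ω ((_ , ())  , p) | yes _
        ... | no ¬p = ¬p p

      Hit-suc : ∀ v → Hit (suc v) ≈ Pr (intersection eP (#-generated xs v))
      Hit-suc v = Pr-cong _ _ (to , from)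
        where
        to : ((E ∩ (λ ω → # (x ∷ xs) ω ≡ suc v)) ∩ P x) ⊆ ((E ∩ P x) ∩ (λ ω → # xs ω ≡ v))
        to {ω} ((Eω , eq) , p) with P? x ω
        ... | yes _ = (Eω , p) , ℕ.suc-injective eq
        ... | no ¬p = contradiction p ¬p

        from : ((E ∩ P x) ∩ (λ ω → # xs ω ≡ v)) ⊆ ((E ∩ (λ ω → # (x ∷ xs) ω ≡ suc v)) ∩ P x)
        from {ω} ((Eω , p) , eq) with P? x ω
        ... | yes _ = (Eω , ≡.cong suc eq) , p
        ... | no ¬p = contradiction p ¬p

      -- On `P x` the count is positive, so the summand at 0 vanishes; shifting v moves that unit
      -- into the offset.
      hits : ∑ (upTo (suc n)) (λ v → fromℕ (c ℕ.+ v) * Hit v)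
               ≈ (1# + fromℕ c) * Pr eP + ∑ xs (λ y → Pr (intersection eP (P-generated y)))
      hits = begin-equality
        ∑ (upTo (suc n)) (λ v → fromℕ (c ℕ.+ v) * Hit v)
          ≡⟨ ∑-upTo-suc n _ ⟩
        fromℕ (c ℕ.+ 0) * Hit 0 + ∑ (upTo n) (λ v → fromℕ (c ℕ.+ suc v) * Hit (suc v))
          ≈⟨ +-cong (trans (*-congˡ Hit-zero) (zeroʳ _))
               (∑-cong (upTo n) λ v → *-cong (reflexive (≡.cong fromℕ (ℕ.+-suc c v))) (Hit-suc v)) ⟩
        0# + ∑ (upTo n) (λ v → fromℕ (suc c ℕ.+ v) * Pr (intersection eP (#-generated xs v)))
          ≈⟨ +-identityˡ _ ⟩
        ∑ (upTo n) (λ v → fromℕ (suc c ℕ.+ v) * Pr (intersection eP (#-generated xs v)))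
          ≈⟨ ∑-value-Pr xs eP (suc c) n len<n ⟩
        fromℕ (suc c) * Pr eP + ∑ xs (λ y → Pr (intersection eP (P-generated y)))
          ∎

      Pr-split-∩ : ∀ y → Pr (intersection e (P-generated y))
                         ≈ Pr (intersection eP (P-generated y)) + Pr (intersection e∁ (P-generated y))
      Pr-split-∩ y = trans (Pr-split _ (P-generated x) (P? x))
        (+-cong (Pr-cong _ _ ((λ ((a , b) , c) → (a , c) , b) , λ ((a , b) , c) → (a , c) , b))
                (Pr-cong _ _ ((λ ((a , b) , c) → (a , c) , b) , λ ((a , b) , c) → (a , c) , b)))

    ∑<≈∑ : ∀ n f → ∑< n f ≈ ∑ (upTo n) f
    ∑<≈∑ zero    f = refl
    ∑<≈∑ (suc n) f = trans (+-congˡ (∑<≈∑ n (f ∘ suc))) (reflexive (≡.sym (∑-upTo-suc n f)))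

    -- Linearity of expectation for indicators. No value exceeds `length xs`, so the partial sums
    -- are constant beyond it and no genuine limit occurs.
    #-expectation : ∀ xs → HasExpectation (# xs) (∑ xs (λ x → Pr (P-generated x)))
    #-expectation xs = #-generated xs , eventually-constant⇒converges (suc (length xs)) λ n len<n → begin-equality
      ∑< n (λ v → fromℕ v * Pr (#-generated xs v))
        ≈⟨ ∑<≈∑ n _ ⟩
      ∑ (upTo n) (λ v → fromℕ v * Pr (#-generated xs v))
        ≈⟨ ∑-cong (upTo n) (λ v → *-congˡ (Pr-cong _ _ ((λ x → tt , x) , proj₂))) ⟩
      ∑ (upTo n) (λ v → fromℕ v * Pr (intersection whole (#-generated xs v)))
        ≈⟨ ∑-value-Pr xs whole 0 n len<n ⟩
      0# * Pr whole + ∑ xs (λ x → Pr (intersection whole (P-generated x)))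
        ≈⟨ +-cong (zeroˡ _) (∑-cong xs (λ x → Pr-cong _ _ (proj₂ , λ y → tt , y))) ⟩
      0# + ∑ xs (λ x → Pr (P-generated x))
        ≈⟨ +-identityˡ _ ⟩
      ∑ xs (λ x → Pr (P-generated x)) ∎

-- Repeated entries and linear forms.

-- Independence speaks about lists without repetition. Each value is kept at its last occurrence, so
-- that a tuple can be treated entry by entry from its head.
distinct : ∀ {h} → Vec ℕ h → List ℕ
distinct Vec.[]      = []
distinct (x Vec.∷ k) = if does (x Vecᴹ.∈? k) then distinct k else x ∷ distinct k

∈-distinct⁻ : ∀ {h} (k : Vec ℕ h) {x} → x List.∈ distinct k → x Vecᴹ.∈ k
∈-distinct⁻ (y Vec.∷ k) x∈ with y Vecᴹ.∈? k
∈-distinct⁻ (y Vec.∷ k) x∈          | yes _ = there (∈-distinct⁻ k x∈)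
∈-distinct⁻ (y Vec.∷ k) (here x≡y)  | no  _ = here x≡y
∈-distinct⁻ (y Vec.∷ k) (there x∈k) | no  _ = there (∈-distinct⁻ k x∈k)

∈-distinct⁺ : ∀ {h} (k : Vec ℕ h) {x} → x Vecᴹ.∈ k → x List.∈ distinct k
∈-distinct⁺ (y Vec.∷ k) x∈ with y Vecᴹ.∈? k
∈-distinct⁺ (y Vec.∷ k) (here ≡.refl) | yes y∈k = ∈-distinct⁺ k y∈k
∈-distinct⁺ (y Vec.∷ k) (there x∈k)   | yes _   = ∈-distinct⁺ k x∈k
∈-distinct⁺ (y Vec.∷ k) (here x≡y)    | no  _   = here x≡y
∈-distinct⁺ (y Vec.∷ k) (there x∈k)   | no  _   = there (∈-distinct⁺ k x∈k)

distinct-unique : ∀ {h} (k : Vec ℕ h) → Unique (distinct k)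
distinct-unique Vec.[]      = []
distinct-unique (x Vec.∷ k) with x Vecᴹ.∈? k
... | yes _   = distinct-unique k
... | no  x∉k = Listᴬ.tabulate (λ y∈ x≡y → x∉k (≡.subst (Vecᴹ._∈ k) (≡.sym x≡y) (∈-distinct⁻ k y∈)))
                ∷ distinct-unique k

dot : ∀ {h} → Vec ℕ h → Vec ℕ h → ℕ
dot []      []      = 0
dot (m ∷ ms) (x ∷ k) = m ℕ.* x ℕ.+ dot ms k

dot-replicate-1 : ∀ {h} (k : Vec ℕ h) → dot (Vec.replicate h 1) k ≡ Vec.sum k
dot-replicate-1 []      = ≡.refl
dot-replicate-1 (x ∷ k) = ≡.cong₂ ℕ._+_ (ℕ.*-identityˡ x) (dot-replicate-1 k)

sum-replicate-1 : ∀ h → Vec.sum (Vec.replicate h 1) ≡ h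
sum-replicate-1 zero    = ≡.refl
sum-replicate-1 (suc h) = ≡.cong suc (sum-replicate-1 h)

all-replicate-1 : ∀ h → All (1 ℕ.≤_) (Vec.replicate h 1)
all-replicate-1 zero    = []
all-replicate-1 (suc h) = s≤s z≤n ∷ all-replicate-1 h

-- The new coefficients when an entry of coefficient `m` turns out to equal the entry at `i`.
addAt : ∀ {h} → ℕ → Vec ℕ h → Fin h → Vec ℕ h
addAt m ms i = Vec.updateAt ms i (m ℕ.+_)

dot-addAt : ∀ {h} m (ms k : Vec ℕ h) i → dot (addAt m ms i) k ≡ m ℕ.* Vec.lookup k i ℕ.+ dot ms k
dot-addAt m (m′ ∷ ms) (x ∷ k) Fin.zero = ≡.trans
  (≡.cong (ℕ._+ dot ms k) (ℕ.*-distribʳ-+ x m m′)) (ℕ.+-assoc (m ℕ.* x) _ _)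
dot-addAt m (m′ ∷ ms) (x ∷ k) (Fin.suc i) = ≡.trans
  (≡.cong (m′ ℕ.* x ℕ.+_) (dot-addAt m ms k i))
  (solve 3 (λ a b c → a :+ (b :+ c) := b :+ (a :+ c)) ≡.refl (m′ ℕ.* x) (m ℕ.* Vec.lookup k i) (dot ms k))
  where open +-*-Solver

-- Merging two entries preserves the total of the coefficients, so one bound on that total serves
-- the whole induction.
sum-addAt : ∀ {h} m (ms : Vec ℕ h) i → Vec.sum (addAt m ms i) ≡ m ℕ.+ Vec.sum ms
sum-addAt m (m′ ∷ ms) Fin.zero    = ℕ.+-assoc m m′ _
sum-addAt m (m′ ∷ ms) (Fin.suc i) = ≡.trans (≡.cong (m′ ℕ.+_) (sum-addAt m ms i))
  (solve 3 (λ a b c → a :+ (b :+ c) := b :+ (a :+ c)) ≡.refl m′ m (Vec.sum ms))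
  where open +-*-Solver

all-addAt : ∀ {h} m {ms : Vec ℕ h} i → All (1 ℕ.≤_) ms → All (1 ℕ.≤_) (addAt m ms i)
all-addAt m Fin.zero    (1≤ ∷ 1≤s) = ℕ.≤-trans 1≤ (ℕ.m≤n+m _ m) ∷ 1≤s
all-addAt m (Fin.suc i) (1≤ ∷ 1≤s) = 1≤ ∷ all-addAt m i 1≤s

-- Shifts, point masses and sums over progressions.

module Shift (ℝ : RealNumbers) where

  open RealNumbers ℝ
  open OrderedField ℝ
  open ≤-Reasoning

  -- f (n − s), read as 0# when s exceeds n.
  at : (ℕ → Carrier) → ℕ → ℕ → Carrier
  at f n       zero    = f n
  at f zero    (suc s) = 0#
  at f (suc n) (suc s) = at f n s

  -- Avoids truncated subtraction: the shifted argument appears as a `t` with s + t ≡ n, the form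
  -- that the estimates use.
  at-elim : ∀ f (Q : Carrier → Set) n s → Q 0# → (∀ t → s ℕ.+ t ≡ n → Q (f t)) → Q (at f n s)
  at-elim f Q n       zero    q0 q = q n ≡.refl
  at-elim f Q zero    (suc s) q0 q = q0
  at-elim f Q (suc n) (suc s) q0 q = at-elim f Q n s q0 (λ t eq → q t (≡.cong suc eq))

  at-nonneg : ∀ {f} → (∀ n → 0# ≤ f n) → ∀ n s → 0# ≤ at f n s
  at-nonneg {f} 0≤f n s = at-elim f (0# ≤_) n s ≤.refl (λ t _ → 0≤f t)

  at-≤ : ∀ f {n s} → s ℕ.≤ n → at f n s ≡ f (n ℕ.∸ s)
  at-≤ f z≤n       = ≡.refl
  at-≤ f (s≤s s≤n) = at-≤ f s≤n

  -- Separates one entry from a linear form, so that it can be summed out while the others remain in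
  -- the shift.
  at-+ : ∀ f n s t → at f n (s ℕ.+ t) ≡ at (λ n′ → at f n′ t) n s
  at-+ f n       zero    t = ≡.refl
  at-+ f zero    (suc s) t = ≡.refl
  at-+ f (suc n) (suc s) t = at-+ f n s t

  at-∑ : ∀ {X : Set} (xs : List X) (c : X → Carrier) (F : X → ℕ → Carrier) n s →
         at (λ n′ → ∑ xs (λ x → c x * F x n′)) n s ≈ ∑ xs (λ x → c x * at (F x) n s)
  at-∑ xs c F n       zero    = refl
  at-∑ xs c F zero    (suc s) = sym (trans (∑-cong xs (λ x → zeroʳ (c x))) (∑-0 xs))
  at-∑ xs c F (suc n) (suc s) = at-∑ xs c F n s

  -- The unit of convolution. `at δ₀ n s` is the indicator of s = n, so the condition on the sum of
  -- a tuple is the case `f = δ₀` of estimates for general `f`.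
  δ₀ : ℕ → Carrier
  δ₀ zero    = 1#
  δ₀ (suc _) = 0#

  δ₀-nonneg : ∀ n → 0# ≤ δ₀ n
  δ₀-nonneg zero    = 0≤1
  δ₀-nonneg (suc _) = ≤.refl

  δ : ℕ → ℕ → Carrier
  δ x y = if x ≡ᵇ y then 1# else 0#

  δ-nonneg : ∀ x y → 0# ≤ δ x y
  δ-nonneg x y with x ≡ᵇ y
  ... | true  = 0≤1
  ... | false = ≤.refl

  δ-refl : ∀ x → δ x x ≡ 1#
  δ-refl zero    = ≡.refl
  δ-refl (suc x) = δ-refl x

  at-δ₀ : ∀ n s → at δ₀ n s ≡ δ s n
  at-δ₀ zero    zero    = ≡.refl
  at-δ₀ (suc n) zero    = ≡.refl
  at-δ₀ zero    (suc s) = ≡.refl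
  at-δ₀ (suc n) (suc s) = at-δ₀ n s

  -- An inequality, because `j` may lie outside `upTo n`; the sum is then 0.
  ∑-δ : ∀ n j {c : ℕ → Carrier} → (∀ x → 0# ≤ c x) → ∑ (upTo n) (λ x → δ x j * c x) ≤ c j
  ∑-δ zero    j       0≤c = 0≤c j
  ∑-δ (suc n) zero    {c} 0≤c = begin
    ∑ (upTo (suc n)) (λ x → δ x 0 * c x)           ≡⟨ ∑-upTo-suc n _ ⟩
    1# * c 0 + ∑ (upTo n) (λ x → 0# * c (suc x))
      ≈⟨ +-cong (*-identityˡ _) (trans (∑-cong (upTo n) (λ x → zeroˡ _)) (∑-0 (upTo n))) ⟩
    c 0 + 0#                                       ≈⟨ +-identityʳ _ ⟩
    c 0                                            ∎
  ∑-δ (suc n) (suc j) {c} 0≤c = begin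
    ∑ (upTo (suc n)) (λ x → δ x (suc j) * c x)       ≡⟨ ∑-upTo-suc n _ ⟩
    0# * c 0 + ∑ (upTo n) (λ x → δ x j * c (suc x))  ≈⟨ trans (+-congʳ (zeroˡ _)) (+-identityˡ _) ⟩
    ∑ (upTo n) (λ x → δ x j * c (suc x))             ≤⟨ ∑-δ n j (0≤c ∘ suc) ⟩
    c (suc j)                                        ∎

  ∑-at≤ : ∀ {f} → (∀ n → 0# ≤ f n) → ∀ n s → ∑ (upTo n) (λ i → at f i s) ≤ ∑ (upTo n) f
  ∑-at≤ 0≤f n       zero    = ≤.refl
  ∑-at≤ 0≤f zero    (suc s) = ≤.refl
  ∑-at≤ {f} 0≤f (suc n) (suc s) = begin
    ∑ (upTo (suc n)) (λ i → at f i (suc s)) ≡⟨ ∑-upTo-suc n _ ⟩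
    0# + ∑ (upTo n) (λ i → at f i s)        ≈⟨ +-identityˡ _ ⟩
    ∑ (upTo n) (λ i → at f i s)             ≤⟨ ∑-at≤ 0≤f n s ⟩
    ∑ (upTo n) f                            ≤⟨ ∑-upTo-mono-≤ 0≤f (ℕ.n≤1+n n) ⟩
    ∑ (upTo (suc n)) f                      ∎

  -- The numbers n − m x are distinct because m is positive.
  ∑-at-*≤ : ∀ {f} → (∀ n → 0# ≤ f n) → ∀ M n m → 1 ℕ.≤ m →
            ∑ (upTo M) (λ x → at f n (m ℕ.* x)) ≤ ∑ (upTo (suc n)) f
  ∑-at-*≤ 0≤f zero    n m 1≤m = ∑-nonneg (upTo (suc n)) 0≤f
  ∑-at-*≤ {f} 0≤f (suc M) n m 1≤m = begin
    ∑ (upTo (suc M)) (λ x → at f n (m ℕ.* x))                    ≡⟨ ∑-upTo-suc M _ ⟩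
    at f n (m ℕ.* 0) + ∑ (upTo M) (λ x → at f n (m ℕ.* suc x))
      ≈⟨ +-cong (reflexive (≡.cong (at f n) (ℕ.*-zeroʳ m))) (trans (∑-cong (upTo M) shift) (sym (at-∑ (upTo M) _ _ n m))) ⟩
    f n + at (λ n′ → ∑ (upTo M) (λ x → 1# * at f n′ (m ℕ.* x))) n m
      ≤⟨ +-mono-≤ ≤.refl (at-elim _ (_≤ ∑ (upTo n) f) n m (∑-nonneg (upTo n) 0≤f) remaining) ⟩
    f n + ∑ (upTo n) f                                           ≈⟨ +-comm _ _ ⟩
    ∑ (upTo n) f + f n
      ≈⟨ +-congˡ (trans (sym (+-identityʳ _)) (+-congʳ (reflexive (≡.cong f (≡.sym (ℕ.+-identityʳ n)))))) ⟩
    ∑ (upTo n) f + ∑ (upTo 1) (λ i → f (n ℕ.+ i))                ≈⟨ ∑-upTo-+ n 1 f ⟨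
    ∑ (upTo (n ℕ.+ 1)) f
      ≡⟨ ≡.cong (λ k → ∑ (upTo k) f) (ℕ.+-comm n 1) ⟩
    ∑ (upTo (suc n)) f                                           ∎
    where
    shift : ∀ x → at f n (m ℕ.* suc x) ≈ 1# * at (λ n′ → at f n′ (m ℕ.* x)) n m
    shift x = trans (reflexive (≡.trans (≡.cong (at f n) (ℕ.*-suc m x)) (at-+ f n m (m ℕ.* x)))) (sym (*-identityˡ _))

    -- Here t = n - m < n, so these terms fit into `upTo n` and the index n stays free for x = 0.
    remaining : ∀ t → m ℕ.+ t ≡ n → ∑ (upTo M) (λ x → 1# * at f t (m ℕ.* x)) ≤ ∑ (upTo n) f
    remaining t m+t≡n = begin
      ∑ (upTo M) (λ x → 1# * at f t (m ℕ.* x)) ≈⟨ ∑-cong (upTo M) (λ x → *-identityˡ _) ⟩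
      ∑ (upTo M) (λ x → at f t (m ℕ.* x))      ≤⟨ ∑-at-*≤ 0≤f M t m 1≤m ⟩
      ∑ (upTo (suc t)) f
        ≤⟨ ∑-upTo-mono-≤ 0≤f (≡.subst (suc t ℕ.≤_) m+t≡n (ℕ.+-monoˡ-≤ t 1≤m)) ⟩
      ∑ (upTo n) f                             ∎

-- Upper bound for the weighted sum over tuples.

module Weights (ℝ : RealNumbers) (p : ℕ → RealNumbers.Carrier ℝ)
               (0≤p : ∀ x → RealNumbers._≤_ ℝ (RealNumbers.0# ℝ) (p x)) where

  open RealNumbers ℝ
  open Probability ℝ
  open OrderedField ℝ
  open Shift ℝ
  open ≤-Reasoning

  -- For p x = Pr(x ∈ ω), the probability that ω contains every entry of `k`.
  weight : ∀ {h} → Vec ℕ h → Carrier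
  weight k = ∏ (map p (distinct k))

  weight-nonneg : ∀ {h} (k : Vec ℕ h) → 0# ≤ weight k
  weight-nonneg []      = 0≤1
  weight-nonneg (x ∷ k) with x Vecᴹ.∈? k
  ... | yes _ = weight-nonneg k
  ... | no  _ = *-nonneg (0≤p x) (weight-nonneg k)

  -- A union bound over coincidences. If `x` is new, the first summand is exact; otherwise some δ
  -- equals 1 and the other summands are nonnegative. The factor `t` will carry the linear
  -- condition.
  weight-∷ : ∀ {h} x (k : Vec ℕ h) {t} → 0# ≤ t → weight (x ∷ k) * t
             ≤ p x * (weight k * t) + ∑ (allFin h) (λ i → δ x (Vec.lookup k i) * (weight k * t))
  weight-∷ {h} x k {t} 0≤t with x Vecᴹ.∈? k
  ... | no  _   = ≤.trans (≤.reflexive (*-assoc _ _ _))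
                    (x≤x+y (∑-nonneg (allFin h) (λ i → *-nonneg (δ-nonneg x _) 0≤wt)))
    where 0≤wt = *-nonneg (weight-nonneg k) 0≤t
  ... | yes x∈k = begin
    weight k * t                                  ≈⟨ *-identityˡ _ ⟨
    1# * (weight k * t)
      ≡⟨ ≡.cong (_* (weight k * t)) (≡.trans (≡.sym (δ-refl x)) (≡.cong (δ x) (lookup-index x∈k))) ⟩
    δ x (Vec.lookup k (Any.index x∈k)) * (weight k * t)
      ≤⟨ ∑-member (λ i → *-nonneg (δ-nonneg x _) 0≤wt) (List.∈-allFin (Any.index x∈k)) ⟩
    ∑ (allFin h) (λ i → δ x (Vec.lookup k i) * (weight k * t))
      ≤⟨ y≤x+y (*-nonneg (0≤p x) 0≤wt) ⟩
    p x * (weight k * t) + ∑ (allFin h) (λ i → δ x (Vec.lookup k i) * (weight k * t)) ∎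
    where 0≤wt = *-nonneg (weight-nonneg k) 0≤t

  ∑-sum≡n : ∀ h n → ∑ (box h n) (λ k → if does (Vec.sum k ℕ.≟ n) then weight k else 0#)
                    ≈ ∑ (box h n) (λ k → weight k * at δ₀ n (Vec.sum k))
  ∑-sum≡n h n = ∑-cong (box h n) λ k → trans (if-* (Vec.sum k ≡ᵇ n) (weight k))
                                             (*-congˡ (reflexive (≡.sym (at-δ₀ n (Vec.sum k)))))
    where
    if-* : ∀ b w → (if b then w else 0#) ≈ w * (if b then 1# else 0#)
    if-* true  w = sym (*-identityʳ w)
    if-* false w = sym (zeroʳ w)

  module Upper (N : ℕ) (S : Carrier) (1≤S : 1# ≤ S)
               (∑p≤S : ∑ (upTo (suc N)) p ≤ S)
               (p-decay : ∀ x → x ℕ.≤ N → p x * fromℕ (suc x) ≤ S) where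

    0≤S : 0# ≤ S
    0≤S = ≤.trans 0≤1 1≤S

    -- `decay` at n = N gives the final estimate; `total` is what lets `decay` survive a
    -- convolution. The hypotheses on `p` make `p` itself `Bounded S`.
    record Bounded (B : Carrier) (f : ℕ → Carrier) : Set where
      field
        nonneg : ∀ n → 0# ≤ f n
        decay  : ∀ n → n ℕ.≤ N → f n * fromℕ (suc n) ≤ B
        total  : ∑ (upTo (suc N)) f ≤ B

      0≤B : 0# ≤ B
      0≤B = ≤.trans (∑-nonneg (upTo (suc N)) nonneg) total

    δ₀-bounded : Bounded 1# δ₀
    δ₀-bounded = record { nonneg = δ₀-nonneg ; decay = decay ; total = total }
      where
      decay : ∀ n → n ℕ.≤ N → δ₀ n * fromℕ (suc n) ≤ 1#
      decay zero    _ = ≤.reflexive (trans (*-identityˡ _) (+-identityʳ 1#))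
      decay (suc n) _ = ≤.trans (≤.reflexive (zeroˡ _)) 0≤1

      total : ∑ (upTo (suc N)) δ₀ ≤ 1#
      total = ≤.reflexive (trans (reflexive (∑-upTo-suc N δ₀)) (trans (+-congˡ (∑-0 (upTo N))) (+-identityʳ 1#)))

    convolve : ℕ → (ℕ → Carrier) → ℕ → Carrier
    convolve m f n = ∑ (upTo (suc N)) (λ x → p x * at f n (m ℕ.* x))

    -- In m + 1, the part m comes from the decay of `p` against the total of `f`, with m because x
    -- is scaled by m; the part 1 comes from the decay of `f` against the total of `p`.
    convolve-bounded : ∀ {B f} m → 1 ℕ.≤ m → Bounded B f → Bounded (fromℕ (suc m) * S * B) (convolve m f)
    convolve-bounded {B} {f} m 1≤m bf = record { nonneg = nonneg′ ; decay = decay′ ; total = total′ }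
      where
      open Bounded bf

      nonneg′ : ∀ n → 0# ≤ convolve m f n
      nonneg′ n = ∑-nonneg (upTo (suc N)) (λ x → *-nonneg (0≤p x) (at-nonneg nonneg n (m ℕ.* x)))

      -- n + 1 ≤ m (x + 1) + (t + 1): either factor absorbs one of the summands.
      term : ∀ n → n ℕ.≤ N → ∀ x →
             p x * at f n (m ℕ.* x) * fromℕ (suc n) ≤ fromℕ m * S * at f n (m ℕ.* x) + B * p x
      term n n≤N x = at-elim f (λ y → p x * y * fromℕ (suc n) ≤ fromℕ m * S * y + B * p x) n (m ℕ.* x)
        (begin
          p x * 0# * fromℕ (suc n)   ≈⟨ trans (*-congʳ (zeroʳ _)) (zeroˡ _) ⟩
          0#                         ≤⟨ *-nonneg 0≤B (0≤p x) ⟩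
          B * p x                    ≈⟨ trans (sym (+-identityˡ _)) (+-congʳ (sym (zeroʳ _))) ⟩
          fromℕ m * S * 0# + B * p x ∎)
        λ t mx+t≡n → begin
          p x * f t * fromℕ (suc n)
            ≤⟨ *-monoˡ-≤ _ (*-nonneg (0≤p x) (nonneg t)) (fromℕ-mono-≤ (1+n≤ t mx+t≡n)) ⟩
          p x * f t * fromℕ (m ℕ.* suc x ℕ.+ suc t)
            ≈⟨ *-congˡ (trans (fromℕ-homo-+ (m ℕ.* suc x) (suc t)) (+-congʳ (fromℕ-homo-* m (suc x)))) ⟩
          p x * f t * (fromℕ m * fromℕ (suc x) + fromℕ (suc t))
            ≈⟨ solve 5 (λ p f m x t → p :* f :* (m :* x :+ t) := m :* f :* (p :* x) :+ f :* t :* p) refl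
                 (p x) (f t) (fromℕ m) (fromℕ (suc x)) (fromℕ (suc t)) ⟩
          fromℕ m * f t * (p x * fromℕ (suc x)) + f t * fromℕ (suc t) * p x
            ≤⟨ +-mono-≤ (*-monoˡ-≤ _ (*-nonneg (fromℕ-nonneg m) (nonneg t)) (p-decay x (ℕ.≤-trans (x≤n t mx+t≡n) n≤N)))
                        (*-monoʳ-≤ _ (0≤p x) (decay t (ℕ.≤-trans (t≤n t mx+t≡n) n≤N))) ⟩
          fromℕ m * f t * S + B * p x
            ≈⟨ +-congʳ (solve 3 (λ m f s → m :* f :* s := m :* s :* f) refl (fromℕ m) (f t) S) ⟩
          fromℕ m * S * f t + B * p x ∎
        where
        t≤n : ∀ t → m ℕ.* x ℕ.+ t ≡ n → t ℕ.≤ n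
        t≤n t eq = ≡.subst (t ℕ.≤_) eq (ℕ.m≤n+m t (m ℕ.* x))

        x≤n : ∀ t → m ℕ.* x ℕ.+ t ≡ n → x ℕ.≤ n
        x≤n t eq = ≡.subst (x ℕ.≤_) eq
          (ℕ.≤-trans (ℕ.≤-trans (ℕ.≤-reflexive (≡.sym (ℕ.*-identityˡ x))) (ℕ.*-monoˡ-≤ x 1≤m)) (ℕ.m≤m+n (m ℕ.* x) t))

        1+n≤ : ∀ t → m ℕ.* x ℕ.+ t ≡ n → suc n ℕ.≤ m ℕ.* suc x ℕ.+ suc t
        1+n≤ t eq = ≡.subst (ℕ._≤ m ℕ.* suc x ℕ.+ suc t) (≡.trans (ℕ.+-suc _ t) (≡.cong suc eq))
          (ℕ.+-monoˡ-≤ (suc t) (ℕ.*-monoʳ-≤ m (ℕ.n≤1+n x)))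

      decay′ : ∀ n → n ℕ.≤ N → convolve m f n * fromℕ (suc n) ≤ fromℕ (suc m) * S * B
      decay′ n n≤N = begin
        convolve m f n * fromℕ (suc n)
          ≈⟨ ∑-*ʳ (upTo (suc N)) _ _ ⟨
        ∑ (upTo (suc N)) (λ x → p x * at f n (m ℕ.* x) * fromℕ (suc n))
          ≤⟨ ∑-mono-≤ (upTo (suc N)) (term n n≤N) ⟩
        ∑ (upTo (suc N)) (λ x → fromℕ m * S * at f n (m ℕ.* x) + B * p x)
          ≈⟨ trans (∑-+ (upTo (suc N)) _ _) (+-cong (∑-*ˡ (upTo (suc N)) _ _) (∑-*ˡ (upTo (suc N)) B p)) ⟩
        fromℕ m * S * ∑ (upTo (suc N)) (λ x → at f n (m ℕ.* x)) + B * ∑ (upTo (suc N)) p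
          ≤⟨ +-mono-≤ (*-monoˡ-≤ _ (*-nonneg (fromℕ-nonneg m) 0≤S)
                         (≤.trans (∑-at-*≤ nonneg (suc N) n m 1≤m)
                                  (≤.trans (∑-upTo-mono-≤ nonneg (s≤s n≤N)) total)))
                      (*-monoˡ-≤ B 0≤B ∑p≤S) ⟩
        fromℕ m * S * B + B * S
          ≈⟨ solve 3 (λ m s b → m :* s :* b :+ b :* s := (con 1 :+ m) :* s :* b) refl (fromℕ m) S B ⟩
        fromℕ (suc m) * S * B ∎

      total′ : ∑ (upTo (suc N)) (convolve m f) ≤ fromℕ (suc m) * S * B
      total′ = begin
        ∑ (upTo (suc N)) (convolve m f)
          ≈⟨ ∑-swap (upTo (suc N)) (upTo (suc N)) _ ⟩
        ∑ (upTo (suc N)) (λ x → ∑ (upTo (suc N)) (λ n → p x * at f n (m ℕ.* x)))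
          ≤⟨ ∑-mono-≤ (upTo (suc N)) (λ x → ≤.trans (≤.reflexive (∑-*ˡ (upTo (suc N)) (p x) _))
               (*-monoˡ-≤ (p x) (0≤p x) (≤.trans (∑-at≤ nonneg (suc N) (m ℕ.* x)) total))) ⟩
        ∑ (upTo (suc N)) (λ x → p x * B)
          ≈⟨ ∑-*ʳ (upTo (suc N)) B p ⟩
        ∑ (upTo (suc N)) p * B
          ≤⟨ *-monoʳ-≤ B 0≤B (≤.trans ∑p≤S (≤.trans (≤.reflexive (sym (*-identityˡ S)))
                                                   (*-monoʳ-≤ S 0≤S (1≤fromℕ-suc m)))) ⟩
        fromℕ (suc m) * S * B ∎

    -- An entry x of the tuple either is new, and then contributes the factor p x,
    -- or repeats a later entry, and then its coefficient is added to that entry's.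
    ∑-weight-decay : ∀ L {h B f} (ms : Vec ℕ h) → All (1 ℕ.≤_) ms → h ℕ.≤ L → Vec.sum ms ℕ.≤ L → Bounded B f →
      ∑ (box h N) (λ k → weight k * at f N (dot ms k)) * fromℕ (suc N) ≤ (fromℕ (suc (L ℕ.+ L)) * S) ^ h * B
    ∑-weight-decay L {zero} {B} {f} [] [] _ _ bf = begin
      (1# * f N + 0#) * fromℕ (suc N) ≈⟨ *-congʳ (trans (+-identityʳ _) (*-identityˡ _)) ⟩
      f N * fromℕ (suc N)             ≤⟨ Bounded.decay bf N ℕ.≤-refl ⟩
      B                               ≈⟨ *-identityˡ B ⟨
      1# * B                          ∎
    ∑-weight-decay L {suc h} {B} {f} (m ∷ ms) (1≤m ∷ 1≤ms) h<L sum≤L bf = begin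
      ∑ (box (suc h) N) (λ k → weight k * at f N (dot (m ∷ ms) k)) * n+1
        ≈⟨ *-congʳ (∑-box h N _) ⟩
      ∑ xs (λ x → ∑ ks (λ k → weight (x ∷ k) * T x k)) * n+1
        ≤⟨ *-monoʳ-≤ n+1 0≤n+1 (≤.trans
             (∑-mono-≤ xs λ x → ≤.trans (∑-mono-≤ ks λ k → weight-∷ x k (0≤T x k)) (≤.reflexive (∑-+ ks _ _)))
             (≤.reflexive (∑-+ xs _ _))) ⟩
      (New + Repeat) * n+1
        ≈⟨ distribʳ _ _ _ ⟩
      New * n+1 + Repeat * n+1
        ≤⟨ +-mono-≤ New≤ Repeat≤ ⟩
      E ^ h * (fromℕ (suc m) * S * B) + fromℕ h * (E ^ h * B)
        -- The repeated entry brought no factor `S`; 1 ≤ S supplies it, and both parts then share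
        -- one power of `S`.
        ≤⟨ +-mono-≤ ≤.refl (*-monoˡ-≤ _ (fromℕ-nonneg h) (≤.trans (≤.reflexive (sym (*-identityˡ _)))
                                                                 (*-monoʳ-≤ _ 0≤EB 1≤S))) ⟩
      E ^ h * (fromℕ (suc m) * S * B) + fromℕ h * (S * (E ^ h * B))
        ≈⟨ solve 5 (λ e m s b h → e :* (m :* s :* b) :+ h :* (s :* (e :* b)) := (m :+ h) :* s :* (e :* b)) refl
             (E ^ h) (fromℕ (suc m)) S B (fromℕ h) ⟩
      (fromℕ (suc m) + fromℕ h) * S * (E ^ h * B)
        ≈⟨ *-congʳ (*-congʳ (fromℕ-homo-+ (suc m) h)) ⟨
      fromℕ (suc m ℕ.+ h) * S * (E ^ h * B)
        -- A factor m + 1 for a new entry and one for each of the h possible coincidences: this is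
        -- the origin of 2 L + 1 in `E`.
        ≤⟨ *-monoʳ-≤ _ 0≤EB (*-monoʳ-≤ S 0≤S (fromℕ-mono-≤ (s≤s (ℕ.+-mono-≤ m≤L h≤L)))) ⟩
      E * (E ^ h * B)
        ≈⟨ *-assoc E _ B ⟨
      E ^ suc h * B ∎
      where
      n+1   = fromℕ (suc N)
      0≤n+1 = fromℕ-nonneg (suc N)
      E     = fromℕ (suc (L ℕ.+ L)) * S
      xs    = upTo (suc N)
      ks    = box h N
      h≤L   = ℕ.<⇒≤ h<L
      m≤L   = ℕ.≤-trans (ℕ.m≤m+n m _) sum≤L
      open Bounded bf

      T : ℕ → Vec ℕ h → Carrier
      T x k = at f N (m ℕ.* x ℕ.+ dot ms k)

      0≤T : ∀ x k → 0# ≤ T x k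
      0≤T x k = at-nonneg nonneg N (m ℕ.* x ℕ.+ dot ms k)

      0≤EB : 0# ≤ E ^ h * B
      0≤EB = *-nonneg (^-nonneg h (*-nonneg (fromℕ-nonneg (suc (L ℕ.+ L))) 0≤S)) 0≤B

      New Repeat : Carrier
      New    = ∑ xs (λ x → ∑ ks (λ k → p x * (weight k * T x k)))
      Repeat = ∑ xs (λ x → ∑ ks (λ k → ∑ (allFin h) (λ i → δ x (Vec.lookup k i) * (weight k * T x k))))

      -- Summing out the new entry replaces `f` by `convolve m f`, hence the induction over all
      -- bounded `f`.
      New≤ : New * n+1 ≤ E ^ h * (fromℕ (suc m) * S * B)
      New≤ = ≤.trans (*-monoʳ-≤ n+1 0≤n+1 (≤.reflexive (trans (∑-swap xs ks _) (∑-cong ks inner))))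
        (∑-weight-decay L ms 1≤ms h≤L (ℕ.≤-trans (ℕ.m≤n+m _ m) sum≤L) (convolve-bounded m 1≤m bf))
        where
        inner : ∀ k → ∑ xs (λ x → p x * (weight k * T x k)) ≈ weight k * at (convolve m f) N (dot ms k)
        inner k = begin-equality
          ∑ xs (λ x → p x * (weight k * T x k))
            ≈⟨ ∑-cong xs (λ x → trans
                 (solve 3 (λ p w t → p :* (w :* t) := w :* (p :* t)) refl (p x) (weight k) (T x k))
                 (*-congˡ (*-congˡ (reflexive (≡.trans (≡.cong (at f N) (ℕ.+-comm (m ℕ.* x) _)) (at-+ f N (dot ms k) _)))))) ⟩
          ∑ xs (λ x → weight k * (p x * at (λ n → at f n (m ℕ.* x)) N (dot ms k)))
            ≈⟨ ∑-*ˡ xs (weight k) _ ⟩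
          weight k * ∑ xs (λ x → p x * at (λ n → at f n (m ℕ.* x)) N (dot ms k))
            ≈⟨ *-congˡ (at-∑ xs p _ N (dot ms k)) ⟨
          weight k * at (convolve m f) N (dot ms k) ∎

      Repeat≤ : Repeat * n+1 ≤ fromℕ h * (E ^ h * B)
      Repeat≤ = begin
        Repeat * n+1
          ≈⟨ *-congʳ (trans (∑-cong xs (λ x → ∑-swap ks (allFin h) _)) (trans (∑-swap xs (allFin h) _)
               (∑-cong (allFin h) (λ i → ∑-swap xs ks _)))) ⟩
        ∑ (allFin h) (λ i → ∑ ks (λ k → ∑ xs (λ x → δ x (Vec.lookup k i) * (weight k * T x k)))) * n+1
          -- The δ forces x to equal the entry at `i`, which collapses the sum over x and changes
          -- the linear form to `addAt m ms i`.
          ≤⟨ *-monoʳ-≤ n+1 0≤n+1 (∑-mono-≤ (allFin h) λ i → ∑-mono-≤ ks λ k →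
               ≤.trans (∑-δ (suc N) (Vec.lookup k i) (λ x → *-nonneg (weight-nonneg k) (0≤T x k)))
                       (≤.reflexive (*-congˡ (reflexive (≡.cong (at f N) (≡.sym (dot-addAt m ms k i))))))) ⟩
        ∑ (allFin h) (λ i → ∑ ks (λ k → weight k * at f N (dot (addAt m ms i) k))) * n+1
          ≈⟨ ∑-*ʳ (allFin h) n+1 _ ⟨
        ∑ (allFin h) (λ i → ∑ ks (λ k → weight k * at f N (dot (addAt m ms i) k)) * n+1)
          ≤⟨ ∑-mono-≤ (allFin h) (λ i → ∑-weight-decay L (addAt m ms i) (all-addAt m i 1≤ms) h≤L
               (ℕ.≤-trans (ℕ.≤-reflexive (sum-addAt m ms i)) sum≤L) bf) ⟩
        ∑ (allFin h) (λ i → E ^ h * B)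
          ≈⟨ trans (∑-const (allFin h) _) (*-congʳ (reflexive (≡.cong fromℕ (List.length-tabulate {n = h} id)))) ⟩
        fromℕ h * (E ^ h * B) ∎

    ∑-sum≡N-decay : ∀ h → ∑ (box h N) (λ k → weight k * at δ₀ N (Vec.sum k)) * fromℕ (suc N)
                          ≤ (fromℕ (suc (h ℕ.+ h)) * S) ^ h
    ∑-sum≡N-decay h = begin
      ∑ (box h N) (λ k → weight k * at δ₀ N (Vec.sum k)) * fromℕ (suc N)
        ≈⟨ *-congʳ (∑-cong (box h N) (λ k → *-congˡ (reflexive (≡.cong (at δ₀ N) (≡.sym (dot-replicate-1 k)))))) ⟩
      ∑ (box h N) (λ k → weight k * at δ₀ N (dot (Vec.replicate h 1) k)) * fromℕ (suc N)
        -- There are h coefficients, all equal to 1, so L = h bounds both their number and their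
        -- total.
        ≤⟨ ∑-weight-decay h (Vec.replicate h 1) (all-replicate-1 h) ℕ.≤-refl (ℕ.≤-reflexive (sum-replicate-1 h)) δ₀-bounded ⟩
      (fromℕ (suc (h ℕ.+ h)) * S) ^ h * 1#
        ≈⟨ *-identityʳ _ ⟩
      (fromℕ (suc (h ℕ.+ h)) * S) ^ h ∎

-- Lower bound by convolution powers.

module Lower (ℝ : RealNumbers) (p : ℕ → RealNumbers.Carrier ℝ)
             (0≤p : ∀ x → RealNumbers._≤_ ℝ (RealNumbers.0# ℝ) (p x))
             (p≤1 : ∀ x → RealNumbers._≤_ ℝ (p x) (RealNumbers.1# ℝ)) where

  open RealNumbers ℝ
  open OrderedField ℝ
  open Shift ℝ
  open Weights ℝ p 0≤p
  open ≤-Reasoning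

  ∏p : ∀ {h} → Vec ℕ h → Carrier
  ∏p []      = 1#
  ∏p (x ∷ k) = p x * ∏p k

  ∏p-nonneg : ∀ {h} (k : Vec ℕ h) → 0# ≤ ∏p k
  ∏p-nonneg []      = 0≤1
  ∏p-nonneg (x ∷ k) = *-nonneg (0≤p x) (∏p-nonneg k)

  -- The extra factors of a repeated entry are at most 1, so the lower bound may ignore
  -- coincidences.
  ∏p≤weight : ∀ {h} (k : Vec ℕ h) → ∏p k ≤ weight k
  ∏p≤weight []      = ≤.refl
  ∏p≤weight (x ∷ k) with x Vecᴹ.∈? k
  ... | yes _ = ≤.trans (*-mono-≤ 0≤1 (∏p-nonneg k) (p≤1 x) (∏p≤weight k)) (≤.reflexive (*-identityˡ _))
  ... | no  _ = *-monoˡ-≤ (p x) (0≤p x) (∏p≤weight k)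

  -- The h-fold convolution power of `p` at n, with entries at most N. The cut-off is separate from
  -- n because the recursion lowers n inside a fixed box.
  Q : ℕ → ℕ → ℕ → Carrier
  Q N h n = ∑ (box h N) (λ k → ∏p k * at δ₀ n (Vec.sum k))

  Q-nonneg : ∀ N h n → 0# ≤ Q N h n
  Q-nonneg N h n = ∑-nonneg (box h N) (λ k → *-nonneg (∏p-nonneg k) (at-nonneg δ₀-nonneg n (Vec.sum k)))

  Q-suc : ∀ N h n → Q N (suc h) n ≈ ∑ (upTo (suc N)) (λ x → p x * at (Q N h) n x)
  Q-suc N h n = trans (∑-box h N _) (∑-cong (upTo (suc N)) λ x → begin-equality
    ∑ (box h N) (λ k → p x * ∏p k * at δ₀ n (x ℕ.+ Vec.sum k))
      ≈⟨ ∑-cong (box h N) (λ k → trans (*-assoc _ _ _) (*-congˡ (*-congˡ (reflexive (at-+ δ₀ n x (Vec.sum k)))))) ⟩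
    ∑ (box h N) (λ k → p x * (∏p k * at (λ n′ → at δ₀ n′ (Vec.sum k)) n x))
      ≈⟨ ∑-*ˡ (box h N) (p x) _ ⟩
    p x * ∑ (box h N) (λ k → ∏p k * at (λ n′ → at δ₀ n′ (Vec.sum k)) n x)
      ≈⟨ *-congˡ (at-∑ (box h N) ∏p _ n x) ⟨
    p x * at (Q N h) n x ∎)

  Q-summand-nonneg : ∀ N h n x → 0# ≤ p x * at (Q N h) n x
  Q-summand-nonneg N h n x = *-nonneg (0≤p x) (at-nonneg (Q-nonneg N h) n x)

  p≤Q : ∀ {N n} → n ℕ.≤ N → p n ≤ Q N 1 n
  p≤Q {N} {n} n≤N = begin
    p n                                          ≈⟨ *-identityʳ (p n) ⟨
    p n * 1#
      ≈⟨ *-congˡ (sym (trans (reflexive eq) (trans (+-identityʳ _) (*-identityˡ _)))) ⟩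
    p n * at (Q N 0) n n
      ≤⟨ ∑-member (Q-summand-nonneg N 0 n) (List.∈-upTo⁺ (s≤s n≤N)) ⟩
    ∑ (upTo (suc N)) (λ x → p x * at (Q N 0) n x) ≈⟨ Q-suc N 0 n ⟨
    Q N 1 n                                      ∎
    where
    eq : at (Q N 0) n n ≡ Q N 0 0
    eq = ≡.trans (at-≤ (Q N 0) (ℕ.≤-refl {n})) (≡.cong (Q N 0) (ℕ.n∸n≡0 n))

  module _ (A : ℕ → ℕ) (A-mono : ∀ {x y} → x ℕ.≤ y → A x ℕ.≤ A y)
           (p-A : ∀ x → p x * fromℕ (suc x) ≈ fromℕ (A x))
           (D u₀ : ℕ) (A-growth : ∀ u n → u₀ ℕ.≤ u → n ℕ.< 4 ℕ.* suc u → A n ℕ.≤ D ℕ.* A u) where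

    ^≤⇒*-^≤ : ∀ {m n} k {y} → m ℕ.≤ D ℕ.* n → fromℕ n ^ k ≤ y → fromℕ m ^ k ≤ fromℕ D ^ k * y
    ^≤⇒*-^≤ {m} {n} k {y} m≤Dn n^k≤y = begin
      fromℕ m ^ k
        ≤⟨ ^-mono-≤ k (fromℕ-nonneg m) (≤.trans (fromℕ-mono-≤ m≤Dn) (≤.reflexive (fromℕ-homo-* D n))) ⟩
      (fromℕ D * fromℕ n) ^ k ≈⟨ ^-distrib-* (fromℕ D) (fromℕ n) k ⟩
      fromℕ D ^ k * fromℕ n ^ k ≤⟨ *-monoˡ-≤ _ (^-nonneg k (fromℕ-nonneg D)) n^k≤y ⟩
      fromℕ D ^ k * y         ∎

    -- The summands x ∈ [u, 2u) with u = ⌊n/4⌋ suffice: there x and n − x are both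
    -- at least u, so A x and A (n − x) are comparable to A n.
    Q-lower : ∀ h → ∃[ c ] ∃[ n₀ ] (0# ≤ c × (∀ N n → n₀ ℕ.≤ n → n ℕ.≤ N →
              fromℕ (A n) ^ suc h ≤ c * (fromℕ (suc n) * Q N (suc h) n)))
    Q-lower zero = 1# , 0 , 0≤1 , λ N n _ n≤N → begin
      fromℕ (A n) * 1#               ≈⟨ *-identityʳ _ ⟩
      fromℕ (A n)                    ≈⟨ p-A n ⟨
      p n * fromℕ (suc n)            ≤⟨ *-monoʳ-≤ _ (fromℕ-nonneg (suc n)) (p≤Q n≤N) ⟩
      Q N 1 n * fromℕ (suc n)        ≈⟨ trans (*-comm _ _) (sym (*-identityˡ _)) ⟩
      1# * (fromℕ (suc n) * Q N 1 n) ∎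
    Q-lower (suc h) with Q-lower h
    -- The power of `D` replaces A n by A u, the 2 comes from x + 1 ≤ 2 u, and `c` from the
    -- induction hypothesis.
    ... | c , n₀ , 0≤c , ih = fromℕ D ^ suc (suc h) * (c * fromℕ 2) , 4 ℕ.* b ,
          *-nonneg (^-nonneg (suc (suc h)) (fromℕ-nonneg D)) (*-nonneg 0≤c (fromℕ-nonneg 2)) , bound
      where
      -- Ensures that u = n / 4 is at least `u₀` for the growth bound, at least `n₀` for the
      -- induction hypothesis at n - x ≥ u, and positive so that it can be cancelled.
      b = suc (n₀ ℕ.+ u₀)

      bound : ∀ N n → 4 ℕ.* b ℕ.≤ n → n ℕ.≤ N → fromℕ (A n) ^ suc (suc h)
              ≤ fromℕ D ^ suc (suc h) * (c * fromℕ 2) * (fromℕ (suc n) * Q N (suc (suc h)) n)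
      bound N n 4b≤n n≤N = begin
        fromℕ (A n) ^ suc (suc h)
          ≤⟨ ^≤⇒*-^≤ (suc (suc h)) (A-growth u n u₀≤u n<4u+4) (*-cancelʳ-≤ 0<u main) ⟩
        fromℕ D ^ suc (suc h) * (c * fromℕ 2 * (fromℕ (suc n) * Q N (suc (suc h)) n))
          ≈⟨ *-assoc _ _ _ ⟨
        fromℕ D ^ suc (suc h) * (c * fromℕ 2) * (fromℕ (suc n) * Q N (suc (suc h)) n) ∎
        where
        u = n ℕ./ 4
        α = fromℕ (A u)

        b≤u : b ℕ.≤ u
        b≤u = ℕ.≤-trans (ℕ.≤-reflexive (≡.sym (≡.trans (≡.cong (ℕ._/ 4) (ℕ.*-comm 4 b)) (ℕ.m*n/n≡m b 4)))) (ℕ./-monoˡ-≤ 4 4b≤n)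

        u₀≤u : u₀ ℕ.≤ u
        u₀≤u = ℕ.≤-trans (ℕ.m≤n+m u₀ (suc n₀)) b≤u

        n₀≤u : n₀ ℕ.≤ u
        n₀≤u = ℕ.≤-trans (ℕ.m≤n⇒m≤1+n (ℕ.m≤m+n n₀ u₀)) b≤u

        0<u : 0# < fromℕ u
        0<u with u | b≤u
        ... | suc u′ | _ = fromℕ-suc>0 u′

        n≡ : n ≡ n ℕ.% 4 ℕ.+ u ℕ.* 4
        n≡ = ℕ.m≡m%n+[m/n]*n n 4

        n<4u+4 : n ℕ.< 4 ℕ.* suc u
        n<4u+4 = ≡.subst₂ ℕ._<_ (≡.sym n≡) (ℕ.*-comm (suc u) 4) (ℕ.+-monoˡ-< (u ℕ.* 4) (ℕ.m%n<n n 4))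

        3u≤n : 3 ℕ.* u ℕ.≤ n
        3u≤n = ℕ.≤-trans (ℕ.≤-trans (ℕ.*-monoˡ-≤ u {3} {4} (s≤s (s≤s (s≤s z≤n)))) (ℕ.≤-reflexive (ℕ.*-comm 4 u))) (ℕ.m/n*n≤m n 4)

        summand : ∀ y → y ℕ.< u → α ^ suc (suc h)
                  ≤ (c * fromℕ 2 * (fromℕ (suc n) * fromℕ u)) * (p (u ℕ.+ y) * at (Q N (suc h)) n (u ℕ.+ y))
        summand y y<u = begin
          α * α ^ suc h
            ≤⟨ *-mono-≤ (≤.trans (fromℕ-nonneg (A u)) α≤) (^-nonneg (suc h) (fromℕ-nonneg (A u))) α≤ α^≤ ⟩
          p x * (fromℕ 2 * fromℕ u) * (c * (fromℕ (suc n) * q))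
            ≈⟨ solve 6 (λ p t u c n q → p :* (t :* u) :* (c :* (n :* q)) := (c :* t :* (n :* u)) :* (p :* q)) refl
                 (p x) (fromℕ 2) (fromℕ u) c (fromℕ (suc n)) q ⟩
          (c * fromℕ 2 * (fromℕ (suc n) * fromℕ u)) * (p x * q) ∎
          where
          x = u ℕ.+ y
          q = at (Q N (suc h)) n x

          2u≡ : u ℕ.+ u ≡ 2 ℕ.* u
          2u≡ = ≡.cong (u ℕ.+_) (≡.sym (ℕ.+-identityʳ u))

          x<2u : x ℕ.< 2 ℕ.* u
          x<2u = ≡.subst (x ℕ.<_) 2u≡ (ℕ.+-monoʳ-< u y<u)

          u+x≤n : u ℕ.+ x ℕ.≤ n
          u+x≤n = ℕ.≤-trans (ℕ.+-monoʳ-≤ u (ℕ.<⇒≤ x<2u)) 3u≤n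

          x≤n : x ℕ.≤ n
          x≤n = ℕ.≤-trans (ℕ.m≤n+m x u) u+x≤n

          u≤n∸x : u ℕ.≤ n ℕ.∸ x
          u≤n∸x = ℕ.m+n≤o⇒m≤o∸n u u+x≤n

          α≤ : α ≤ p x * (fromℕ 2 * fromℕ u)
          α≤ = begin
            α                         ≤⟨ fromℕ-mono-≤ (A-mono (ℕ.m≤m+n u y)) ⟩
            fromℕ (A x)               ≈⟨ p-A x ⟨
            p x * fromℕ (suc x)       ≤⟨ *-monoˡ-≤ _ (0≤p x) (fromℕ-mono-≤ x<2u) ⟩
            p x * fromℕ (2 ℕ.* u)     ≈⟨ *-congˡ (fromℕ-homo-* 2 u) ⟩
            p x * (fromℕ 2 * fromℕ u) ∎

          α^≤ : α ^ suc h ≤ c * (fromℕ (suc n) * q)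
          α^≤ = begin
            α ^ suc h
              ≤⟨ ^-mono-≤ (suc h) (fromℕ-nonneg (A u)) (fromℕ-mono-≤ (A-mono u≤n∸x)) ⟩
            fromℕ (A (n ℕ.∸ x)) ^ suc h
              ≤⟨ ih N (n ℕ.∸ x) (ℕ.≤-trans n₀≤u u≤n∸x) (ℕ.≤-trans (ℕ.m∸n≤m n x) n≤N) ⟩
            c * (fromℕ (suc (n ℕ.∸ x)) * Q N (suc h) (n ℕ.∸ x))
              ≤⟨ *-monoˡ-≤ c 0≤c (*-monoʳ-≤ _ (Q-nonneg N (suc h) (n ℕ.∸ x)) (fromℕ-mono-≤ (s≤s (ℕ.m∸n≤m n x)))) ⟩
            c * (fromℕ (suc n) * Q N (suc h) (n ℕ.∸ x))
              ≡⟨ ≡.cong (λ y → c * (fromℕ (suc n) * y)) (at-≤ (Q N (suc h)) x≤n) ⟨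
            c * (fromℕ (suc n) * q)                         ∎

        u+u≤N : u ℕ.+ u ℕ.≤ suc N
        u+u≤N = ℕ.≤-trans (ℕ.+-monoʳ-≤ u (ℕ.m≤m+n u _)) (ℕ.≤-trans 3u≤n (ℕ.m≤n⇒m≤1+n n≤N))

        F : ℕ → Carrier
        F x = p x * at (Q N (suc h)) n x

        -- The bound for a single summand loses a factor u; adding u of them makes up for it.
        main : α ^ suc (suc h) * fromℕ u ≤ c * fromℕ 2 * (fromℕ (suc n) * Q N (suc (suc h)) n) * fromℕ u
        main = begin
          α ^ suc (suc h) * fromℕ u
            ≈⟨ trans (*-comm _ _) (sym (∑-upTo-const u _)) ⟩
          ∑ (upTo u) (λ _ → α ^ suc (suc h))
            ≤⟨ ∑-upTo-mono-< u summand ⟩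
          ∑ (upTo u) (λ y → c * fromℕ 2 * (fromℕ (suc n) * fromℕ u) * F (u ℕ.+ y))
            ≈⟨ ∑-*ˡ (upTo u) _ _ ⟩
          c * fromℕ 2 * (fromℕ (suc n) * fromℕ u) * ∑ (upTo u) (λ y → F (u ℕ.+ y))
            ≤⟨ *-monoˡ-≤ _ (*-nonneg (*-nonneg 0≤c (fromℕ-nonneg 2)) (*-nonneg (fromℕ-nonneg (suc n)) (fromℕ-nonneg u))) part≤Q ⟩
          c * fromℕ 2 * (fromℕ (suc n) * fromℕ u) * Q N (suc (suc h)) n
            ≈⟨ solve 5 (λ c t n u q → c :* t :* (n :* u) :* q := c :* t :* (n :* q) :* u) refl c (fromℕ 2) (fromℕ (suc n)) (fromℕ u) _ ⟩
          c * fromℕ 2 * (fromℕ (suc n) * Q N (suc (suc h)) n) * fromℕ u ∎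
          where
          part≤Q : ∑ (upTo u) (λ y → F (u ℕ.+ y)) ≤ Q N (suc (suc h)) n
          part≤Q = begin
            ∑ (upTo u) (λ y → F (u ℕ.+ y))
              ≤⟨ y≤x+y (∑-nonneg (upTo u) (Q-summand-nonneg N (suc h) n)) ⟩
            ∑ (upTo u) F + ∑ (upTo u) (λ y → F (u ℕ.+ y))  ≈⟨ ∑-upTo-+ u u F ⟨
            ∑ (upTo (u ℕ.+ u)) F
              ≤⟨ ∑-upTo-mono-≤ (Q-summand-nonneg N (suc h) n) u+u≤N ⟩
            ∑ (upTo (suc N)) F                             ≈⟨ Q-suc N (suc h) n ⟨
            Q N (suc (suc h)) n                            ∎

-- The expected number of representations.

module Representations (ℝ : RealNumbers) {𝒜 : InfiniteSubset} (S : Probability.𝒮 ℝ 𝒜) where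

  open RealNumbers ℝ
  open Probability ℝ
  open OrderedField ℝ
  open ≤-Reasoning
  open 𝒮 S
  open MeasureTheory ℝ measure

  p : ℕ → Carrier
  p i = Pr (generator i)

  0≤p : ∀ i → 0# ≤ p i
  0≤p i = Pr-nonneg (generator i)

  open Weights ℝ p 0≤p using (weight)

  private
    G : ℕ → Pred InfiniteSubset 0ℓ
    G n ω = n ∈ ω

  ⋂-distinct : ∀ {h} (k : Vec ℕ h) → ⋂generators G (distinct k) ≐ (λ ω → Vecᴬ.All (_∈ ω) k)
  ⋂-distinct k = (λ ω∈ → Vecᴬ.lookup⁻ (λ i → ∈⋂⇒∈G ω∈ (∈-distinct⁺ k (∈-lookup i k))))
               , (λ all → ∈⋂ (distinct k) (λ x∈ → Vecᴬ.lookup all (∈-distinct⁻ k x∈)))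
    where
    ∈⋂⇒∈G : ∀ {F ω i} → ⋂generators G F ω → i List.∈ F → G i ω
    ∈⋂⇒∈G (g , _) (here ≡.refl) = g
    ∈⋂⇒∈G (_ , r) (there i∈F)   = ∈⋂⇒∈G r i∈F

    ∈⋂ : ∀ F {ω} → (∀ {i} → i List.∈ F → G i ω) → ⋂generators G F ω
    ∈⋂ []      g = tt
    ∈⋂ (i ∷ F) g = g (here ≡.refl) , ∈⋂ F (λ i∈F → g (there i∈F))

  ⊆ω-generated : ∀ {h} (k : Vec ℕ h) → Generated G (λ ω → Vecᴬ.All (_∈ ω) k)
  ⊆ω-generated k = respects (⋂-distinct k) (⋂-generated G (distinct k))

  -- Independence enters here, after the repetitions have been removed.
  Pr-⊆ω : ∀ {h} (k : Vec ℕ h) → Pr (⊆ω-generated k) ≈ weight k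
  Pr-⊆ω k = trans
    (Pr-cong (⊆ω-generated k) (⋂-generated G (distinct k)) (proj₂ (⋂-distinct k) , proj₁ (⋂-distinct k)))
    (independent (distinct-unique k))

  module _ (h n : ℕ) where

    private
      Rep : Vec ℕ h → Pred InfiniteSubset 0ℓ
      Rep k ω = Vecᴬ.All (_∈ ω) k × Vec.sum k ≡ n

      -- The condition on the sum of a tuple does not involve ω; once decided, it is the whole space
      -- or the empty event.
      const-generated : ∀ {A : Set} → Dec A → Generated G (λ _ → A)
      const-generated (yes a) = respects ((λ _ → a) , (λ _ → tt)) whole
      const-generated (no ¬a) = respects ((λ ω∈∅ → ⊥-elim (ω∈∅ tt)) , (λ a → ⊥-elim (¬a a))) ∅-generated

      Rep-generated : ∀ k → Generated G (Rep k)
      Rep-generated k = intersection (⊆ω-generated k) (const-generated (Vec.sum k ℕ.≟ n))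

      Pr-∩const : ∀ {A : Set} {E} (e : Generated G E) (A? : Dec A) →
                  Pr (intersection e (const-generated A?)) ≈ (if does A? then Pr e else 0#)
      Pr-∩const e (yes a) = Pr-cong _ e (proj₁ , λ x → x , a)
      Pr-∩const e (no ¬a) = Pr-empty _ (λ _ (_ , a) → ¬a a)

    𝔼r : Carrier
    𝔼r = ∑ (box h n) (λ k → Pr (Rep-generated k))

    𝔼r≈ : 𝔼r ≈ ∑ (box h n) (λ k → if does (Vec.sum k ℕ.≟ n) then weight k else 0#)
    𝔼r≈ = ∑-cong (box h n) λ k →
      trans (Pr-∩const (⊆ω-generated k) (Vec.sum k ℕ.≟ n)) (if-cong (does (Vec.sum k ℕ.≟ n)) (Pr-⊆ω k))
      where
      if-cong : ∀ b {x y} → x ≈ y → (if b then x else 0#) ≈ (if b then y else 0#)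
      if-cong true  x≈y = x≈y
      if-cong false x≈y = refl

    r-expectation : HasExpectation (r h n) 𝔼r
    r-expectation = #-expectation (box h n)
      -- `r h n` unfolds to the counting variable of `Rep`; unification finds the decision procedure
      -- inside `r`.
      where open Counting Rep _ Rep-generated

-- Counting function and enumeration.

increments⇒mono-≤ : ∀ {f : ℕ → ℕ} → (∀ n → f n ℕ.≤ f (suc n)) → ∀ {m n} → m ℕ.≤ n → f m ℕ.≤ f n
increments⇒mono-≤ {f} step {m} m≤n = go (ℕ.≤⇒≤′ m≤n)
  where
  go : ∀ {n} → m ℕ.≤′ n → f m ℕ.≤ f n
  go ℕ.≤′-refl       = ℕ.≤-refl
  go (ℕ.≤′-step m≤n) = ℕ.≤-trans (go m≤n) (step _)

module Enumeration (𝒜 : InfiniteSubset) where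

  open +-*-Solver using (solve; _:+_; _:*_; _:=_; con)

  -- Counts on [0, x) so that inductions start from an empty interval; `count 𝒜 x` is
  -- `below (suc x)` by definition.
  below : ℕ → ℕ
  below x = length (filter (_∈? 𝒜) (upTo x))

  below-suc : ∀ x → below (suc x) ≡ below x ℕ.+ length (filter (_∈? 𝒜) (x ∷ []))
  below-suc x = ≡.trans
    (≡.cong (length ∘ filter (_∈? 𝒜)) (≡.sym (List.upTo-∷ʳ x)))
    (≡.trans (≡.cong length (List.filter-++ (_∈? 𝒜) (upTo x) (x ∷ [])))
             (List.length-++ (filter (_∈? 𝒜) (upTo x))))

  below-suc-∈ : ∀ {x} → x ∈ 𝒜 → below (suc x) ≡ suc (below x)
  below-suc-∈ {x} x∈ = ≡.trans (below-suc x)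
    (≡.trans (≡.cong (λ xs → below x ℕ.+ length xs) (List.filter-accept (_∈? 𝒜) {x} {[]} x∈)) (ℕ.+-comm _ 1))

  below-suc-∉ : ∀ {x} → ¬ x ∈ 𝒜 → below (suc x) ≡ below x
  below-suc-∉ {x} x∉ = ≡.trans (below-suc x)
    (≡.trans (≡.cong (λ xs → below x ℕ.+ length xs) (List.filter-reject (_∈? 𝒜) {x} {[]} x∉)) (ℕ.+-identityʳ _))

  below-mono-≤ : ∀ {x y} → x ℕ.≤ y → below x ℕ.≤ below y
  below-mono-≤ = increments⇒mono-≤ λ x → ℕ.≤-trans (ℕ.m≤m+n _ _) (ℕ.≤-reflexive (≡.sym (below-suc x)))

  count-mono-≤ : ∀ {x y} → x ℕ.≤ y → count 𝒜 x ℕ.≤ count 𝒜 y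
  count-mono-≤ x≤y = below-mono-≤ (s≤s x≤y)

  count≤suc : ∀ x → count 𝒜 x ℕ.≤ suc x
  count≤suc x = ℕ.≤-trans (List.length-filter (_∈? 𝒜) (upTo (suc x))) (ℕ.≤-reflexive (List.length-upTo (suc x)))

  module _ {a : ℕ → ℕ} (a-enum : IsEnumeration a 𝒜) where

    a-mono-≤ : ∀ {m n} → m ℕ.≤ n → a m ℕ.≤ a n
    a-mono-≤ = increments⇒mono-≤ (λ n → ℕ.<⇒≤ (proj₁ a-enum n))

    a-mono-< : ∀ {m n} → m ℕ.< n → a m ℕ.< a n
    a-mono-< m<n = ℕ.<-≤-trans (proj₁ a-enum _) (a-mono-≤ m<n)

    -- `below x` is the first index whose term reaches x. If x = a j is a member, the two bounds for
    -- x force j = `below x`, so the next index is the right one for x + 1.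
    below-spec : ∀ x → (∀ i → i ℕ.< below x → a i ℕ.< x) × x ℕ.≤ a (below x)
    below-spec zero    = (λ _ ()) , z≤n
    below-spec (suc x) with below-spec x | x ∈? 𝒜
    ... | i<⇒ , x≤a | no x∉ rewrite below-suc-∉ x∉ = (λ i i< → ℕ.m<n⇒m<1+n (i<⇒ i i<)) ,
          ℕ.≤∧≢⇒< x≤a (λ x≡a → x∉ (Equivalence.from (proj₂ a-enum x) (below x , ≡.sym x≡a)))
    ... | i<⇒ , x≤a | yes x∈ rewrite below-suc-∈ x∈ with Equivalence.to (proj₂ a-enum x) x∈
    ...   | j , ≡.refl = (λ { i (s≤s i≤) → s≤s (ℕ.≤-trans (a-mono-≤ i≤) (ℕ.≤-reflexive (≡.cong a (≡.sym j≡)))) }) ,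
            ≡.subst (λ z → suc (a z) ℕ.≤ a (suc (below (a j)))) (≡.sym j≡) (proj₁ a-enum _)
      where
      j≡ : j ≡ below (a j)
      j≡ with ℕ.<-cmp j (below (a j))
      ... | tri< j< _ _ = contradiction (i<⇒ j j<) (ℕ.<-irrefl ≡.refl)
      ... | tri≈ _ eq _ = eq
      ... | tri> _ _ >j = contradiction (ℕ.<-≤-trans (a-mono-< >j) x≤a) (ℕ.<-irrefl ≡.refl)

    <count⇒a≤ : ∀ {i x} → i ℕ.< count 𝒜 x → a i ℕ.≤ x
    <count⇒a≤ {i} {x} i< = ℕ.≤-pred (proj₁ (below-spec (suc x)) i i<)

    a≤⇒<count : ∀ {i x} → a i ℕ.≤ x → i ℕ.< count 𝒜 x
    a≤⇒<count {i} {x} a≤x = ℕ.≰⇒> λ count≤i →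
      ℕ.<⇒≱ (proj₂ (below-spec (suc x))) (ℕ.≤-trans (a-mono-≤ count≤i) a≤x)

    -- a (2n) ≤ c a n, read for n = count x − 1.
    count-doubles : ∀ c n₀ → (∀ n → n₀ ℕ.≤ n → a (2 ℕ.* n) ℕ.≤ c ℕ.* a n) →
                    ∀ x → n₀ ℕ.< count 𝒜 x → 2 ℕ.* count 𝒜 x ℕ.≤ suc (count 𝒜 (c ℕ.* x))
    count-doubles c n₀ a-double x n₀< = go (count 𝒜 x) ≡.refl n₀<
      where
      go : ∀ k → count 𝒜 x ≡ k → n₀ ℕ.< k → 2 ℕ.* k ℕ.≤ suc (count 𝒜 (c ℕ.* x))
      go (suc n) eq (s≤s n₀≤n) = ℕ.≤-trans
        (ℕ.≤-reflexive (solve 1 (λ n → con 2 :* (con 1 :+ n) := con 2 :+ con 2 :* n) ≡.refl n))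
        (s≤s (a≤⇒<count (ℕ.≤-trans (a-double n n₀≤n)
          (ℕ.*-monoʳ-≤ c (<count⇒a≤ (ℕ.≤-reflexive (≡.sym eq)))))))

-- The sum of the probabilities.

module Mean (ℝ : RealNumbers) (p : ℕ → RealNumbers.Carrier ℝ)
            (0≤p : ∀ x → RealNumbers._≤_ ℝ (RealNumbers.0# ℝ) (p x))
            (A : ℕ → ℕ) (A-mono : ∀ {x y} → x ℕ.≤ y → A x ℕ.≤ A y)
            (p-A : ∀ x → RealNumbers._≈_ ℝ (RealNumbers._*_ ℝ (p x) (RealNumbers.fromℕ ℝ (suc x)))
                                           (RealNumbers.fromℕ ℝ (A x))) where

  open RealNumbers ℝ
  open OrderedField ℝ hiding (solve; _:+_; _:*_; _:=_; con)
  open +-*-Solver using (solve; _:+_; _:*_; _:=_; con)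
  open ≤-Reasoning

  p-decay : ∀ {x N} → x ℕ.≤ N → p x * fromℕ (suc x) ≤ fromℕ (A N)
  p-decay {x} x≤N = ≤.trans (≤.reflexive (p-A x)) (fromℕ-mono-≤ (A-mono x≤N))

  -- Each term is at most A N / (x + 1), and there are at most k (x + 1) of them.
  ∑p-block : ∀ x d {N} k → x ℕ.+ d ℕ.≤ suc N → d ℕ.≤ k ℕ.* suc x →
             ∑ (upTo d) (λ y → p (x ℕ.+ y)) ≤ fromℕ (k ℕ.* A N)
  ∑p-block x d {N} k x+d≤1+N d≤ = *-cancelʳ-≤ (fromℕ-suc>0 x) (begin
    ∑ (upTo d) (λ y → p (x ℕ.+ y)) * fromℕ (suc x)   ≈⟨ ∑-*ʳ (upTo d) _ _ ⟨
    ∑ (upTo d) (λ y → p (x ℕ.+ y) * fromℕ (suc x))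
      ≤⟨ ∑-upTo-mono-< d (λ y y<d → ≤.trans
           (*-monoˡ-≤ _ (0≤p (x ℕ.+ y)) (fromℕ-mono-≤ (s≤s (ℕ.m≤m+n x y))))
           (p-decay (ℕ.≤-pred (ℕ.≤-trans (ℕ.+-monoʳ-< x y<d) x+d≤1+N)))) ⟩
    ∑ (upTo d) (λ _ → fromℕ (A N))                   ≈⟨ ∑-upTo-const d _ ⟩
    fromℕ d * fromℕ (A N)                            ≈⟨ fromℕ-homo-* d (A N) ⟨
    fromℕ (d ℕ.* A N)                                ≤⟨ fromℕ-mono-≤ (ℕ.≤-trans (ℕ.*-monoˡ-≤ (A N) d≤)
                                                          (ℕ.≤-reflexive (solve 3 (λ k x a → k :* x :* a := k :* a :* x) ≡.refl k (suc x) (A N)))) ⟩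
    fromℕ (k ℕ.* A N ℕ.* suc x)                      ≈⟨ fromℕ-homo-* (k ℕ.* A N) (suc x) ⟩
    fromℕ (k ℕ.* A N) * fromℕ (suc x)                ∎)

  -- By doubling, the part of the sum up to N/M is at most about half of the
  -- claimed bound, and each of the remaining terms is at most A N / (N/M + 1).
  ∑p≤ : ∀ c x₀ → 1 ℕ.≤ x₀ → (∀ x → x₀ ℕ.≤ x → 2 ℕ.≤ A x) →
        (∀ x → x₀ ℕ.≤ x → 2 ℕ.* A x ℕ.≤ suc (A (c ℕ.* x))) →
        ∀ N → ∑ (upTo (suc N)) p ≤ fromℕ ((2 ℕ.+ c) ℕ.* (4 ℕ.+ x₀) ℕ.* A N)
  ∑p≤ c x₀ 1≤x₀ 2≤A A-doubles = <-rec _ step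
    where
    -- M ≥ 2 makes x = N / M smaller than N, and M ≥ c gives c x ≤ N, whence 2 A x ≤ A N + 1. In
    -- `K`, the x₀ covers the case N < M x₀, and the 4 is what `slack` requires at A N = 2.
    M = 2 ℕ.+ c
    K = M ℕ.* (4 ℕ.+ x₀)

    step : ∀ N → (∀ {x} → x ℕ.< N → ∑ (upTo (suc x)) p ≤ fromℕ (K ℕ.* A x)) →
           ∑ (upTo (suc N)) p ≤ fromℕ (K ℕ.* A N)
    step N ih with x₀ ℕ.≤? N ℕ./ M
    ... | no x₀≰ = ∑p-block 0 (suc N) K ℕ.≤-refl (ℕ.≤-trans N<Mx₀
          (ℕ.≤-trans (ℕ.*-monoʳ-≤ M (ℕ.m≤n+m x₀ 4)) (ℕ.≤-reflexive (≡.sym (ℕ.*-identityʳ K)))))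
      where
      N<Mx₀ : N ℕ.< M ℕ.* x₀
      N<Mx₀ = ℕ.<-≤-trans (ℕ.≤-<-trans (ℕ.≤-reflexive (ℕ.m≡m%n+[m/n]*n N M)) (ℕ.+-monoˡ-< _ (ℕ.m%n<n N M)))
        (ℕ.≤-trans (ℕ.*-monoˡ-≤ M (ℕ.≰⇒> x₀≰)) (ℕ.≤-reflexive (ℕ.*-comm x₀ M)))
    ... | yes x₀≤x = begin
      ∑ (upTo (suc N)) p                                       ≡⟨ ≡.cong (λ n → ∑ (upTo n) p) (≡.sym x+d≡) ⟩
      ∑ (upTo (suc x ℕ.+ d)) p                                 ≈⟨ ∑-upTo-+ (suc x) d p ⟩
      ∑ (upTo (suc x)) p + ∑ (upTo d) (λ y → p (suc x ℕ.+ y))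
        ≤⟨ +-mono-≤ (ih x<N) (∑p-block (suc x) d M (ℕ.≤-reflexive x+d≡) d≤) ⟩
      fromℕ (K ℕ.* A x) + fromℕ (M ℕ.* A N)                    ≈⟨ fromℕ-homo-+ (K ℕ.* A x) (M ℕ.* A N) ⟨
      fromℕ (K ℕ.* A x ℕ.+ M ℕ.* A N)                          ≤⟨ fromℕ-mono-≤ arithmetic ⟩
      fromℕ (K ℕ.* A N)                                        ∎
      where
      x = N ℕ./ M
      d = N ℕ.∸ x

      xM≤N : x ℕ.* M ℕ.≤ N
      xM≤N = ℕ.m/n*n≤m N M

      1≤x : 1 ℕ.≤ x
      1≤x = ℕ.≤-trans 1≤x₀ x₀≤x

      x<xM : x ℕ.< x ℕ.* M
      x<xM = ℕ.≤-trans (ℕ.+-monoˡ-≤ x 1≤x) (ℕ.≤-trans (ℕ.m≤m+n (x ℕ.+ x) (c ℕ.* x))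
        (ℕ.≤-reflexive (solve 2 (λ x c → x :+ x :+ c :* x := x :* (con 2 :+ c)) ≡.refl x c)))

      x<N : x ℕ.< N
      x<N = ℕ.<-≤-trans x<xM xM≤N

      x+d≡ : suc x ℕ.+ d ≡ suc N
      x+d≡ = ≡.cong suc (ℕ.m+[n∸m]≡n (ℕ.<⇒≤ x<N))

      d≤ : d ℕ.≤ M ℕ.* suc (suc x)
      d≤ = ℕ.≤-trans (ℕ.m∸n≤m N x) (ℕ.≤-trans
        (ℕ.<⇒≤ (ℕ.≤-<-trans (ℕ.≤-reflexive (ℕ.m≡m%n+[m/n]*n N M)) (ℕ.+-monoˡ-< _ (ℕ.m%n<n N M))))
        (ℕ.≤-trans (ℕ.≤-reflexive (ℕ.*-comm (suc x) M)) (ℕ.*-monoʳ-≤ M (ℕ.n≤1+n (suc x)))))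

      2Ax≤ : 2 ℕ.* A x ℕ.≤ suc (A N)
      2Ax≤ = ℕ.≤-trans (A-doubles x x₀≤x) (s≤s (A-mono (ℕ.≤-trans
        (ℕ.≤-trans (ℕ.*-monoˡ-≤ x (ℕ.m≤n+m c 2)) (ℕ.≤-reflexive (ℕ.*-comm M x))) xM≤N)))

      2≤AN : 2 ℕ.≤ A N
      2≤AN = ℕ.≤-trans (2≤A x x₀≤x) (A-mono (ℕ.<⇒≤ x<N))

      -- With A N = 2 + e this is 4 + x₀ + 2 (2 + e) ≤ (4 + x₀) (2 + e).
      slack : ∀ {α} → 2 ℕ.≤ α → K ℕ.+ 2 ℕ.* (M ℕ.* α) ℕ.≤ K ℕ.* α
      slack {suc (suc e)} _ = ℕ.≤-trans (ℕ.m≤m+n _ (M ℕ.* (e ℕ.* 2 ℕ.+ x₀ ℕ.+ x₀ ℕ.* e)))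
        (ℕ.≤-reflexive (solve 3 (λ m x e →
          m :* (con 4 :+ x) :+ con 2 :* (m :* (con 2 :+ e)) :+ m :* (e :* con 2 :+ x :+ x :* e)
            := m :* (con 4 :+ x) :* (con 2 :+ e)) ≡.refl M x₀ e))
      slack {suc zero} (s≤s ())

      arithmetic : K ℕ.* A x ℕ.+ M ℕ.* A N ℕ.≤ K ℕ.* A N
      -- Both sides are doubled because it is 2 A x that is bounded.
      arithmetic = ℕ.*-cancelˡ-≤ 2 (ℕ.≤-trans
        (ℕ.≤-reflexive (solve 3 (λ k a b → con 2 :* (k :* a :+ b) := k :* (con 2 :* a) :+ con 2 :* b) ≡.refl K (A x) (M ℕ.* A N)))
        (ℕ.≤-trans (ℕ.+-monoˡ-≤ (2 ℕ.* (M ℕ.* A N)) (ℕ.*-monoʳ-≤ K 2Ax≤))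
        (ℕ.≤-trans (ℕ.≤-reflexive (solve 3 (λ k a b → k :* (con 1 :+ a) :+ b := k :* a :+ (k :+ b)) ≡.refl K (A N) (2 ℕ.* (M ℕ.* A N))))
        (ℕ.≤-trans (ℕ.+-monoʳ-≤ (K ℕ.* A N) (slack 2≤AN))
                   (ℕ.≤-reflexive (solve 1 (λ a → a :+ a := con 2 :* a) ≡.refl (K ℕ.* A N)))))))

-- From explicit inequalities to O-bounds.

module Asymptotics (ℝ : RealNumbers) where

  open RealNumbers ℝ
  open Probability ℝ
  open OrderedField ℝ
  open ≤-Reasoning

  -- The Archimedean property rounds the constant up to a natural number, so both growth conditions
  -- can be used in ℕ.
  =O⇒ℕ : ∀ {f g : ℕ → ℕ} → (λ n → fromℕ (f n)) =O (λ n → fromℕ (g n)) →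
         ∃[ c ] ∃[ n₀ ] (∀ n → n₀ ℕ.≤ n → f n ℕ.≤ c ℕ.* g n)
  =O⇒ℕ {f} {g} (C , n₀ , bound) with archimedean C
  ... | c , C≤c = c , n₀ , λ n n₀≤n → fromℕ-cancel-≤ (begin
    fromℕ (f n)         ≤⟨ x≤∣x∣ _ ⟩
    ∣ fromℕ (f n) ∣     ≤⟨ bound n n₀≤n ⟩
    C * ∣ fromℕ (g n) ∣ ≡⟨ ≡.cong (C *_) (∣x∣≡x (fromℕ-nonneg (g n))) ⟩
    C * fromℕ (g n)     ≤⟨ *-monoʳ-≤ _ (fromℕ-nonneg (g n)) C≤c ⟩
    fromℕ c * fromℕ (g n) ≈⟨ fromℕ-homo-* c (g n) ⟨
    fromℕ (c ℕ.* g n)   ∎)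

  nonneg⇒=O : ∀ {f g : ℕ → Carrier} C n₀ → (∀ n → n₀ ℕ.≤ n → 0# ≤ f n) →
              (∀ n → n₀ ℕ.≤ n → 0# ≤ g n) → (∀ n → n₀ ℕ.≤ n → f n ≤ C * g n) → f =O g
  nonneg⇒=O {f} {g} C n₀ 0≤f 0≤g f≤Cg = C , n₀ , λ n n₀≤n →
    ≡.subst₂ (λ x y → x ≤ C * y) (≡.sym (∣x∣≡x (0≤f n n₀≤n))) (≡.sym (∣x∣≡x (0≤g n n₀≤n))) (f≤Cg n n₀≤n)

  module _ (f g : ℕ → Carrier) (0≤f : ∀ n → 0# ≤ f n) (0≤g : ∀ n → 0# ≤ g n) (C : Carrier) (n₀ : ℕ) where

    private
      0<fromℕ : ∀ {n} → n₀ ℕ.< n → 0# < fromℕ n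
      0<fromℕ {suc n} _ = fromℕ-suc>0 n

      0≤g/n : ∀ n → n₀ ℕ.< n → 0# ≤ g n / fromℕ n
      0≤g/n n n₀<n = *-nonneg (0≤g n) (⁻¹-nonneg (0<fromℕ n₀<n))

    -- The estimates carry n + 1, the claim divides by n; starting beyond `n₀` keeps n positive.
    =O-/ : (∀ n → n₀ ℕ.≤ n → f n * fromℕ (suc n) ≤ C * g n) → f =O (λ n → g n / fromℕ n)
    =O-/ bound = nonneg⇒=O C (suc n₀) (λ n _ → 0≤f n) 0≤g/n λ n n₀<n → begin
      f n
        ≤⟨ x≤y/z (0<fromℕ n₀<n) (≤.trans (*-monoˡ-≤ (f n) (0≤f n) (fromℕ-mono-≤ (ℕ.n≤1+n n)))
                                                             (bound n (ℕ.<⇒≤ n₀<n))) ⟩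
      C * g n / fromℕ n     ≈⟨ *-assoc C (g n) _ ⟩
      C * (g n / fromℕ n)   ∎

    -- In this direction the passage from n + 1 to n costs the factor 2.
    /-=O : 0# ≤ C → (∀ n → n₀ ℕ.≤ n → g n ≤ C * (fromℕ (suc n) * f n)) → (λ n → g n / fromℕ n) =O f
    /-=O 0≤C bound = nonneg⇒=O (C * fromℕ 2) (suc n₀) 0≤g/n (λ n _ → 0≤f n) λ n n₀<n →
      x/z≤y (0<fromℕ n₀<n) (begin
        g n                             ≤⟨ bound n (ℕ.<⇒≤ n₀<n) ⟩
        C * (fromℕ (suc n) * f n)
          ≤⟨ *-monoˡ-≤ C 0≤C (*-monoʳ-≤ (f n) (0≤f n) (fromℕ-mono-≤ (1+n≤2n n₀<n))) ⟩
        C * (fromℕ (2 ℕ.* n) * f n)     ≈⟨ *-congˡ (*-congʳ (fromℕ-homo-* 2 n)) ⟩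
        C * (fromℕ 2 * fromℕ n * f n)
          ≈⟨ solve 4 (λ c t n e → c :* (t :* n :* e) := c :* t :* e :* n) refl C (fromℕ 2) (fromℕ n) (f n) ⟩
        C * fromℕ 2 * f n * fromℕ n     ∎)
      where
      1+n≤2n : ∀ {n} → n₀ ℕ.< n → suc n ℕ.≤ 2 ℕ.* n
      1+n≤2n {n} n₀<n = ℕ.≤-trans (ℕ.+-monoˡ-≤ n (ℕ.≤-trans (s≤s z≤n) n₀<n)) (ℕ.+-monoʳ-≤ n (ℕ.m≤m+n n 0))

-- Both bounds for an OR₊ sequence.

module Theorem (ℝ : RealNumbers) (𝒜 : InfiniteSubset)
               (𝒜-OR₊ : Probability.OR₊ ℝ 𝒜) (S : Probability.𝒮 ℝ 𝒜) where

  open RealNumbers ℝ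
  open Probability ℝ
  open OrderedField ℝ
  open Asymptotics ℝ
  open Enumeration 𝒜
  open Representations ℝ S
  open Shift ℝ using (δ₀; at; at-nonneg; δ₀-nonneg)
  open ≤-Reasoning
  open OR₊ 𝒜-OR₊

  A : ℕ → ℕ
  A = count 𝒜

  p-A : ∀ x → p x * fromℕ (suc x) ≈ fromℕ (A x)
  p-A x = trans (*-congʳ (𝒮.Pr-∈ S x)) (x/y*y≈x (fromℕ (A x)) (fromℕ-suc>0 x))

  p≤1 : ∀ x → p x ≤ 1#
  p≤1 x = *-cancelʳ-≤ (fromℕ-suc>0 x) (begin
    p x * fromℕ (suc x) ≈⟨ p-A x ⟩
    fromℕ (A x)         ≤⟨ fromℕ-mono-≤ (count≤suc x) ⟩
    fromℕ (suc x)       ≈⟨ *-identityˡ _ ⟨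
    1# * fromℕ (suc x)  ∎)

  open Weights ℝ p 0≤p using (weight; weight-nonneg; ∑-sum≡n; module Upper)
  open Mean ℝ p 0≤p A count-mono-≤ p-A
  open Lower ℝ p 0≤p p≤1

  -- Three doublings suffice: for u ≥ 1, n < 4 (u + 1) ≤ 8 u. The threshold `suc x₀` secures u ≥ 1.
  A-growth : ∃[ D ] ∃[ u₀ ] (∀ u n → u₀ ℕ.≤ u → n ℕ.< 4 ℕ.* suc u → A n ℕ.≤ D ℕ.* A u)
  A-growth with =O⇒ℕ count-doubling
  ... | c , x₀ , A-double = c ℕ.* (c ℕ.* c) , suc x₀ , growth
    where
    open +-*-Solver using () renaming (solve to solveℕ; _:+_ to _⊕_; _:*_ to _⊗_; _:=_ to _⊜_; con to conℕ)

    growth : ∀ u n → suc x₀ ℕ.≤ u → n ℕ.< 4 ℕ.* suc u → A n ℕ.≤ c ℕ.* (c ℕ.* c) ℕ.* A u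
    growth u n x₀<u n<4u+4 = ℕR.begin
      A n                          ℕR.≤⟨ count-mono-≤ n≤8u ⟩
      A (2 ℕ.* (2 ℕ.* (2 ℕ.* u)))  ℕR.≤⟨ A-double _ (≤2* (≤2* x₀≤u)) ⟩
      c ℕ.* A (2 ℕ.* (2 ℕ.* u))    ℕR.≤⟨ ℕ.*-monoʳ-≤ c (A-double _ (≤2* x₀≤u)) ⟩
      c ℕ.* (c ℕ.* A (2 ℕ.* u))    ℕR.≤⟨ ℕ.*-monoʳ-≤ c (ℕ.*-monoʳ-≤ c (A-double u x₀≤u)) ⟩
      c ℕ.* (c ℕ.* (c ℕ.* A u))
        ℕR.≡⟨ solveℕ 2 (λ c a → c ⊗ (c ⊗ (c ⊗ a)) ⊜ c ⊗ (c ⊗ c) ⊗ a) ≡.refl c (A u) ⟩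
      c ℕ.* (c ℕ.* c) ℕ.* A u      ℕR.∎
      where
      module ℕR = ℕ.≤-Reasoning

      x₀≤u : x₀ ℕ.≤ u
      x₀≤u = ℕ.<⇒≤ x₀<u

      ≤2* : ∀ {x y} → x ℕ.≤ y → x ℕ.≤ 2 ℕ.* y
      ≤2* {y = y} x≤y = ℕ.≤-trans x≤y (ℕ.m≤m+n y _)

      n≤8u : n ℕ.≤ 2 ℕ.* (2 ℕ.* (2 ℕ.* u))
      n≤8u = ℕ.≤-trans (ℕ.<⇒≤ n<4u+4) (ℕ.≤-trans
        (ℕ.*-monoʳ-≤ 4 (ℕ.+-monoˡ-≤ u (ℕ.≤-trans (s≤s z≤n) x₀<u)))
        (ℕ.≤-reflexive (solveℕ 1 (λ u → conℕ 4 ⊗ (u ⊕ u) ⊜ conℕ 2 ⊗ (conℕ 2 ⊗ (conℕ 2 ⊗ u))) ≡.refl u)))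

  ∑p=O : ∃[ K ] ∃[ x₀ ] (1 ℕ.≤ K × (∀ x → x₀ ℕ.≤ x → 1 ℕ.≤ A x) ×
                         (∀ N → ∑ (upTo (suc N)) p ≤ fromℕ (K ℕ.* A N)))
  ∑p=O with =O⇒ℕ a-doubling
  ... | c , n₀ , a-double = (2 ℕ.+ c) ℕ.* (4 ℕ.+ x₀) , x₀ , s≤s z≤n ,
        (λ x x₀≤x → ℕ.≤-trans (s≤s z≤n) (suc-n₀<A x x₀≤x)) ,
        ∑p≤ c x₀ (ℕ.≤-trans (s≤s z≤n) (proj₁ a-enumerates n₀))
          (λ x x₀≤x → ℕ.≤-trans (s≤s (s≤s z≤n)) (suc-n₀<A x x₀≤x))
          (λ x x₀≤x → count-doubles a-enumerates c n₀ a-double x (ℕ.<-trans (ℕ.n<1+n n₀) (suc-n₀<A x x₀≤x)))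
    where
    -- From this term on A x > n₀ + 1, which yields both A x ≥ 2 and n₀ < A x; the term is positive
    -- because `a` increases strictly.
    x₀ : ℕ
    x₀ = a (suc n₀)

    suc-n₀<A : ∀ x → x₀ ℕ.≤ x → suc n₀ ℕ.< A x
    suc-n₀<A x = a≤⇒<count a-enumerates

  module _ (h : ℕ) where

    private
      e target : ℕ → Carrier
      e        = 𝔼r (suc h)
      target n = fromℕ (A n) ^ suc h

      e≈ : ∀ n → e n ≈ ∑ (box (suc h) n) (λ k → weight k * at δ₀ n (Vec.sum k))
      e≈ n = trans (𝔼r≈ (suc h) n) (∑-sum≡n (suc h) n)

      e-nonneg : ∀ n → 0# ≤ e n
      e-nonneg n = ≤.trans
        (∑-nonneg (box (suc h) n) (λ k → *-nonneg (weight-nonneg k) (at-nonneg δ₀-nonneg n (Vec.sum k))))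
        (≤.reflexive (sym (e≈ n)))

      target-nonneg : ∀ n → 0# ≤ target n
      target-nonneg n = ^-nonneg (suc h) (fromℕ-nonneg (A n))

    𝔼r-upper : e =O (λ n → target n / fromℕ n)
    𝔼r-upper =
      let K , x₀ , 1≤K , 1≤A , ∑p≤KA = ∑p=O in
      =O-/ e target e-nonneg target-nonneg ((l * fromℕ K) ^ suc h) x₀ (bound K x₀ 1≤K 1≤A ∑p≤KA)
      where
      l : Carrier
      l = fromℕ (suc (suc h ℕ.+ suc h))

      bound : ∀ K x₀ → 1 ℕ.≤ K → (∀ x → x₀ ℕ.≤ x → 1 ℕ.≤ A x) →
              (∀ N → ∑ (upTo (suc N)) p ≤ fromℕ (K ℕ.* A N)) →
              ∀ n → x₀ ℕ.≤ n → e n * fromℕ (suc n) ≤ (l * fromℕ K) ^ suc h * target n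
      bound K x₀ 1≤K 1≤A ∑p≤KA n x₀≤n = begin
        e n * fromℕ (suc n)
          ≈⟨ *-congʳ (e≈ n) ⟩
        ∑ (box (suc h) n) (λ k → weight k * at δ₀ n (Vec.sum k)) * fromℕ (suc n)
          ≤⟨ ∑-sum≡N-decay (suc h) ⟩
        (l * fromℕ (K ℕ.* A n)) ^ suc h
          ≈⟨ ^-congˡ (suc h) (trans (*-congˡ (fromℕ-homo-* K (A n))) (sym (*-assoc _ _ _))) ⟩
        (l * fromℕ K * fromℕ (A n)) ^ suc h
          ≈⟨ ^-distrib-* (l * fromℕ K) (fromℕ (A n)) (suc h) ⟩
        (l * fromℕ K) ^ suc h * target n ∎
        where
        A≤KA : A n ℕ.≤ K ℕ.* A n
        A≤KA = ℕ.≤-trans (ℕ.≤-reflexive (≡.sym (ℕ.*-identityˡ (A n)))) (ℕ.*-monoˡ-≤ (A n) 1≤K)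

        1≤KA : 1# ≤ fromℕ (K ℕ.* A n)
        1≤KA = ≤.trans (1≤fromℕ-suc 0) (fromℕ-mono-≤ (ℕ.≤-trans (1≤A n x₀≤n) A≤KA))

        -- The cut-off is n itself and S = K A n, with `K` independent of n; beyond `x₀`, A n ≥ 1
        -- makes S ≥ 1.
        open Upper n (fromℕ (K ℕ.* A n)) 1≤KA (∑p≤KA n)
               (λ x x≤n → ≤.trans (p-decay x≤n) (fromℕ-mono-≤ A≤KA))

    𝔼r-lower : (λ n → target n / fromℕ n) =O e
    𝔼r-lower =
      let D , u₀ , growth = A-growth
          c , n₀ , 0≤c , Q-bound = Q-lower A count-mono-≤ p-A D u₀ growth h in
      /-=O e target e-nonneg target-nonneg c n₀ 0≤c λ n n₀≤n →
      -- The cut-off N is n, matching the box in which `r` counts.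
      ≤.trans (Q-bound n n n₀≤n ℕ.≤-refl)
              (*-monoˡ-≤ c 0≤c (*-monoˡ-≤ (fromℕ (suc n)) (fromℕ-nonneg (suc n)) (Q≤e n)))
      where
      Q≤e : ∀ n → Q n (suc h) n ≤ e n
      Q≤e n = ≤.trans
        (∑-mono-≤ (box (suc h) n) (λ k → *-monoʳ-≤ _ (at-nonneg δ₀-nonneg n (Vec.sum k)) (∏p≤weight k)))
        (≤.reflexive (sym (e≈ n)))

lemma4p2 : (ℝ : RealNumbers) →
    let open RealNumbers ℝ
        open Probability ℝ in
    (𝒜 : InfiniteSubset) → OR₊ 𝒜 → (S : 𝒮 𝒜) →
    (h : ℕ) → h ℕ.≥ 1 →
    ∃[ 𝔼r ] ((∀ n → 𝒮.HasExpectation S (r h n) (𝔼r n)) ×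
             (𝔼r =Θ (λ n → fromℕ (count 𝒜 n) ^ h / fromℕ n)))
lemma4p2 ℝ 𝒜 𝒜-OR₊ S (suc h) _ = 𝔼r (suc h) , r-expectation (suc h) , 𝔼r-upper h , 𝔼r-lower h
  where
  open Representations ℝ S
  open Theorem ℝ 𝒜 𝒜-OR₊ S
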